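{- Let $G$ be a fixed finite simple graph. Each of the following graph families $\mathscr{G}=\{\mathscr{G}_n\}$ is rational, i.e. its generating function $\Xi_{\mathscr G}(x)=\sum_{n}\sum_{K\in\mathscr G_n}W_K(t)\,x^n$ is a rational function of $x$ with coefficients in $\mathbb{Z}[t]$ (there exist $P,Q\in\mathbb{Z}[t][x]$ with $Q$ having nonzero constant term such that $Q\,\Xi_{\mathscr G}=P$): (GC) $\mathscr G_n=\{G\times P_n\}$, $n\ge 1$ (the $G$-cylinders); (GX) for a fixed subgraph $H\subseteq G$, $\mathscr G_n=\{X_n(G,H)\}$, $n\ge1$, where $X_n(G,H)$ is obtained from the disjoint union $G\sqcup (H\times P_n)$ by identifying $H\subseteq G$ with $H\times\{1\}$ (extrusions); (GT) $\mathscr G_n=\{G\times C_n\}$, $n\ge3$ (the $G$-tori); (GE) for a fixed subgraph $H\subseteq G$, $\mathscr G_n=\{E_n(G,H)\}$, $n\ge 3$, where $E_n(G,H)$ is obtained from $G\sqcup (H\times C_n)$ by identifying $H\subseteq G$ with $H\times\{1\}$ (earrings); (GS1) for a fixed edge $e$ of $G$, $\mathscr G_n=\{S_n(G,e)\}$, $n\ge 0$, where $S_n(G,e)$ is obtained from $G$ by subdividing $e$ with $n$ new vertices; (GSm) for a fixed set of edges $F=\{e_1,\dots,e_m\}\subseteq E(G)$, $\mathscr G_n$ consists of the graphs obtained from $G$ by subdividing each $e_k$ with $n_k\ge0$ new vertices, one graph for each tuple $(n_1,\dots,n_m)$ of nonnegative integers with $n_1+\dots+n_m=n$ (counted with mu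ltiplicity).
   Context: All graphs are finite and simple. A coloring of a graph $K$ is a map $c\colon V(K)\to\{0,1\}$ ($0$ = white, $1$ = black). For a coloring $c$, call a vertex $v$ even-white if $c(v)=0$ and $v$ has an even number of black neighbors. The black-white polynomial is $W_K(t)=\sum_{c} t^{\#\{\text{even-white vertices of }c\}}\in\mathbb{Z}[t]$, the sum over all $2^{|V(K)|}$ colorings; $W_\emptyset=1$. $P_n$ is the path graph on $n$ vertices $\{1,\dots,n\}$ and $C_n$ the cycle graph on $n$ vertices $\{1,\dots,n\}$. For graphs $K,K'$, the product $K\times K'$ is the Cartesian (box) product: vertex set $V(K)\times V(K')$, with $(u,u')$ adjacent to $(v,v')$ iff either $u'=v'$ and $u$ is adjacent to $v$ in $K$, or $u=v$ and $u'$ is adjacent to $v'$ in $K'$ (so $P_2\times P_2\cong C_4$). -}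

module Defs where

open import Data.Bool using (Bool; true; false; not; _∧_; _∨_; if_then_else_)
open import Data.Nat using (ℕ; zero; suc; _+_; _∸_; _≡ᵇ_)
open import Data.Fin using (Fin; toℕ)
open import Data.Integer using (ℤ; +_; 0ℤ) renaming (_+_ to _+ℤ_; _*_ to _*ℤ_)
open import Data.List using (List; []; _∷_; _++_; map; concatMap; allFin; upTo; cartesianProduct; filterᵇ)
open import Data.Product using (_×_; _,_; proj₁; proj₂; Σ; ∃)
open import Data.Sum using (_⊎_; inj₁; inj₂)
open import Data.Vec.Functional using () renaming (_∷_ to _◂_; [] to ⟨⟩)
open import Relation.Binary.PropositionalEquality using (_≡_; _≢_)

-- Generic finite graphs: a vertex type, the (duplicate-free) list of the
-- vertices of the graph, and a Boolean adjacency relation.  Only the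
-- listed vertices belong to the graph.

record Graph : Set₁ where
  field
    V     : Set
    verts : List V
    adj   : V → V → Bool
open Graph public

countB : {A : Set} → (A → Bool) → List A → ℕ
countB p []       = 0
countB p (x ∷ xs) = if p x then suc (countB p xs) else countB p xs

isEven : ℕ → Bool
isEven zero    = true
isEven (suc n) = not (isEven n)

-- A coloring of the vertex list vs, stored as its graph: the list of
-- pairs (v , c v) for v in vs (false = white 0, true = black 1).
colorings : {V : Set} → List V → List (List (V × Bool))
colorings []       = [] ∷ []
colorings (v ∷ vs) =
  concatMap (λ c → ((v , false) ∷ c) ∷ ((v , true) ∷ c) ∷ []) (colorings vs)

evenWhite : {V : Set} → (V → V → Bool) → List (V × Bool) → ℕ
evenWhite a c =
  countB (λ vb → not (proj₂ vb) ∧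
                 isEven (countB (λ ub → proj₂ ub ∧ a (proj₁ vb) (proj₁ ub)) c)) c

Wcoeff : Graph → ℕ → ℕ
Wcoeff K k = countB (λ c → evenWhite (adj K) c ≡ᵇ k) (colorings (verts K))

-- 𝒢 n is the (multi)set of graphs of order n, as a list
Family : Set₁
Family = ℕ → List Graph

sumℕ : List ℕ → ℕ
sumℕ []       = 0
sumℕ (x ∷ xs) = x + sumℕ xs

Ξcoeff : Family → ℕ → ℕ → ℤ
Ξcoeff 𝒢 n k = + sumℕ (map (λ K → Wcoeff K k) (𝒢 n))

-- elements of ℤ[t][x] : list (over powers of x) of lists (over powers of t)
Poly2 : Set
Poly2 = List (List ℤ)

at : List ℤ → ℕ → ℤ
at []       _       = 0ℤ
at (a ∷ as) zero    = a
at (a ∷ as) (suc i) = at as i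

atL : List (List ℤ) → ℕ → List ℤ
atL []       _       = []
atL (a ∷ as) zero    = a
atL (a ∷ as) (suc i) = atL as i

coeff2 : Poly2 → ℕ → ℕ → ℤ
coeff2 P i j = at (atL P i) j

sumTo : ℕ → (ℕ → ℤ) → ℤ
sumTo zero    f = f 0
sumTo (suc n) f = sumTo n f +ℤ f (suc n)

mulCoeff : Poly2 → Family → ℕ → ℕ → ℤ
mulCoeff Q 𝒢 n k =
  sumTo n (λ i → sumTo k (λ j → coeff2 Q i j *ℤ Ξcoeff 𝒢 (n ∸ i) (k ∸ j)))

NonzeroConst : Poly2 → Set
NonzeroConst Q = ∃ λ j → coeff2 Q 0 j ≢ 0ℤ

Rational : Family → Set
Rational 𝒢 = ∃ λ (P : Poly2) → ∃ λ (Q : Poly2) →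
  NonzeroConst Q × (∀ n k → mulCoeff Q 𝒢 n k ≡ coeff2 P n k)

FinAdj : ℕ → Set
FinAdj n = Fin n → Fin n → Bool

IsSimple : {n : ℕ} → FinAdj n → Set
IsSimple {n} a = (∀ u v → a u v ≡ a v u) × (∀ u → a u u ≡ false)

_==_ : {n : ℕ} → Fin n → Fin n → Bool
i == j = toℕ i ≡ᵇ toℕ j

IsEdge : {n : ℕ} → FinAdj n → Fin n × Fin n → Set
IsEdge a (u , v) = a u v ≡ true

record Subgraph (n : ℕ) : Set where
  field
    inH : Fin n → Bool
    eH  : Fin n → Fin n → Bool
open Subgraph public

IsSubgraph : {n : ℕ} → FinAdj n → Subgraph n → Set
IsSubgraph a H =
  (∀ u v → eH H u v ≡ eH H v u) ×
  (∀ u v → eH H u v ≡ true → a u v ≡ true) ×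
  (∀ u v → eH H u v ≡ true → inH H u ≡ true)

-- path P_m and cycle C_m on Fin m (vertex i ↔ i+1 ∈ {1,…,m})
adjP : (m : ℕ) → FinAdj m
adjP m i j = (suc (toℕ i) ≡ᵇ toℕ j) ∨ (suc (toℕ j) ≡ᵇ toℕ i)

adjC : (m : ℕ) → FinAdj m
adjC m i j = adjP m i j
  ∨ ((toℕ i ≡ᵇ 0) ∧ (suc (toℕ j) ≡ᵇ m))
  ∨ ((toℕ j ≡ᵇ 0) ∧ (suc (toℕ i) ≡ᵇ m))

box : {n m : ℕ} → FinAdj n → FinAdj m → Graph
box {n} {m} a b = record
  { V     = Fin n × Fin m
  ; verts = cartesianProduct (allFin n) (allFin m)
  ; adj   = λ { (u , i) (v , j) → ((u == v) ∧ b i j) ∨ ((i == j) ∧ a u v) }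
  }

-- G glued along H ⊆ G to H × L, where L is a graph on Fin m and layer 0
-- of H × L is identified with H ⊆ G (layer 0 of the result is G itself)
glue : {n m : ℕ} → FinAdj n → Subgraph n → FinAdj m → Graph
glue {n} {m} a H b = record
  { V     = Fin n × Fin m
  ; verts = filterᵇ (λ { (v , k) → (toℕ k ≡ᵇ 0) ∨ inH H v })
                    (cartesianProduct (allFin n) (allFin m))
  ; adj   = λ { (u , i) (v , j) →
               ((i == j) ∧ (if toℕ i ≡ᵇ 0 then a u v else eH H u v))
             ∨ ((u == v) ∧ inH H u ∧ b i j) }
  }

-- Subdividing edges e_1,…,e_r of G with c_1,…,c_r new vertices.
-- New vertices: inj₂ (k , i), 0 ≤ i < c_k, forming the path
-- (e_k)₁ — (k,0) — (k,1) — … — (k,c_k − 1) — (e_k)₂.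

sameEdge : {n : ℕ} → Fin n × Fin n → Fin n → Fin n → Bool
sameEdge (a , b) u v = ((a == u) ∧ (b == v)) ∨ ((a == v) ∧ (b == u))

subdivide : {n r : ℕ} → FinAdj n → (Fin r → Fin n × Fin n) → (Fin r → ℕ) → Graph
subdivide {n} {r} a F c = record
  { V     = Fin n ⊎ (Fin r × ℕ)
  ; verts = map inj₁ (allFin n)
            ++ concatMap (λ k → map (λ i → inj₂ (k , i)) (upTo (c k))) (allFin r)
  ; adj   = ad
  }
  where
    removed : Fin n → Fin n → Bool
    removed u v = countB (λ k → not (c k ≡ᵇ 0) ∧ sameEdge (F k) u v) (allFin r) ≡ᵇ 0
    attach : Fin n → Fin r × ℕ → Bool
    attach u (k , i) = ((i ≡ᵇ 0) ∧ (u == proj₁ (F k)))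
                     ∨ ((suc i ≡ᵇ c k) ∧ (u == proj₂ (F k)))
    ad : Fin n ⊎ (Fin r × ℕ) → Fin n ⊎ (Fin r × ℕ) → Bool
    ad (inj₁ u) (inj₁ v) = a u v ∧ removed u v
    ad (inj₁ u) (inj₂ p) = attach u p
    ad (inj₂ p) (inj₁ u) = attach u p
    ad (inj₂ (k , i)) (inj₂ (l , j)) =
      (k == l) ∧ ((suc i ≡ᵇ j) ∨ (suc j ≡ᵇ i))

compositions : (r : ℕ) → ℕ → List (Fin r → ℕ)
compositions zero    zero    = ⟨⟩ ∷ []
compositions zero    (suc s) = []
compositions (suc r) s =
  concatMap (λ i → map (λ t → i ◂ t) (compositions r (s ∸ i))) (upTo (suc s))

cylinders : {n : ℕ} → FinAdj n → Family
cylinders a zero    = []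
cylinders a (suc m) = box a (adjP (suc m)) ∷ []

extrusions : {n : ℕ} → FinAdj n → Subgraph n → Family
extrusions a H zero    = []
extrusions a H (suc m) = glue a H (adjP (suc m)) ∷ []

tori : {n : ℕ} → FinAdj n → Family
tori a (suc (suc (suc m))) = box a (adjC (3 + m)) ∷ []
tori a _                   = []

earrings : {n : ℕ} → FinAdj n → Subgraph n → Family
earrings a H (suc (suc (suc m))) = glue a H (adjC (3 + m)) ∷ []
earrings a H _                   = []

subdiv1 : {n : ℕ} → FinAdj n → Fin n × Fin n → Family
subdiv1 a e m = subdivide a (λ (_ : Fin 1) → e) (λ _ → m) ∷ []

subdivM : {n r : ℕ} → FinAdj n → (Fin r → Fin n × Fin n) → Family
subdivM a F m = map (subdivide a F) (compositions _ m)

_≈E_ : {n : ℕ} → Fin n × Fin n → Fin n × Fin n → Bool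
e ≈E f = sameEdge e (proj₁ f) (proj₂ f)

{-# OPTIONS --safe #-}

-- Transfer matrices.  W_K is a sum over colorings of a product of one weight per vertex, and the
-- weight of a vertex depends only on its own color and on the parity of its black neighbours.
-- In a chain of layers, the weight of a layer therefore depends on three consecutive layers only, so
-- the weighted sums over the colorings of the chain, indexed by the first two layers, satisfy
-- F_i = w_i + x Σ_j M_ij F_j with w and M over ℤ[t].  Eliminating one unknown after the other
-- keeps a denominator of the form 1 + x u, hence every F_i is rational.
-- Extrusions and earrings are sums of such chains over the colorings of G (cylinders and tori
-- are the case H = G), and a subdivided edge is a chain of single vertices, which its end vertices
-- notice only through two bits.  Summing over these bits turns the sum over all compositions into
-- a finite sum of products of rational series.

module Submission where

open import Defs
open import Algebra.Bundles using (CommutativeRing)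
import Algebra.Properties.Group as GroupProperties
import Algebra.Properties.Ring as RingProperties
import Algebra.Solver.Ring.NaturalCoefficients.Default as SemiringSolver
open import Data.Bool using (Bool; true; false; not; _∧_; _∨_; _xor_; if_then_else_; T?)
open import Data.Bool.Properties using
  (xor-assoc; xor-identityʳ; ∧-comm; ∧-identityʳ; ∧-zeroʳ; ∨-identityʳ; ∨-comm; ∨-zeroʳ; if-eta; T-≡)
open import Data.Bool.Solver using (module xor-∧-Solver)
open import Data.Empty using (⊥-elim)
open import Data.Fin using (Fin; zero; suc; toℕ)
open import Data.Fin.Properties using (suc-injective; toℕ-injective)
open import Data.Integer using (ℤ; +_; 0ℤ; 1ℤ) renaming (_+_ to _+ℤ_; _*_ to _*ℤ_)
import Data.Integer.Properties as ℤ
open import Data.List using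
  (List; []; _∷_; _++_; map; concatMap; upTo; applyUpTo; cartesianProduct; tabulate; allFin; filterᵇ)
open import Data.List.Membership.Propositional using (_∈_)
open import Data.List.Membership.Propositional.Properties using (∈-cartesianProduct⁺; ∈-cartesianProduct⁻)
open import Data.List.Properties using (map-upTo; filter-++; map-++)
import Data.List.Relation.Binary.Permutation.Propositional as ↭
open ↭ using (_↭_)
open import Data.List.Relation.Binary.Permutation.Propositional.Properties using (++⁺ˡ; shifts)
open import Data.List.Relation.Unary.Any using (here; there)
open import Data.Nat using (ℕ; zero; suc; _≤_; z≤n; s≤s; _≡ᵇ_)
import Data.Nat as ℕ
import Data.Nat.Properties as ℕ
open import Data.Product using (_×_; _,_; proj₁; proj₂; ∃; map₁; map₂)
open import Data.Sum using (_⊎_; inj₁; inj₂)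
open import Data.Unit using (⊤; tt)
open import Data.Vec using (Vec; []; _∷_)
open import Data.Vec.Functional using () renaming (_∷_ to _◂_; [] to ⟨⟩)
open import Function using (_∘_; id; Equivalence)
open import Level using (0ℓ)
open import Relation.Binary.PropositionalEquality as ≡ using (_≡_; _≢_; cong; cong₂; refl)

-- Two obstacles shape the proof. Adjacency is given by disjunctions of cases, whereas a transfer
-- matrix needs contributions that add up layer by layer. Hence black neighbours are counted only
-- modulo 2 and every adjacency is rewritten with `xor`. Each rewriting demands that its cases
-- exclude each other, and this is where the simplicity of G, the distinctness of the subdivided
-- edges and the length of the cycles enter. In a cycle of two layers the double link would cancel
-- modulo 2, so the cyclic series is computed from two layers on and its first term is dropped
-- afterwards. The other obstacle is to obtain polynomial numerators and denominators without
-- fraction fields or determinants. Everything takes place among power series, where a predicate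
-- closed under the ring operations singles out the polynomials. Each unknown on the right of the
-- system carries a factor x, so a pivot is 1 modulo x: it is never zero, and elimination multiplies
-- by it instead of dividing.

private variable
  A B H   : Set
  k m n r : ℕ

-- Formal power series and rationality

record IsSubring (R : CommutativeRing 0ℓ 0ℓ) (P : CommutativeRing.Carrier R → Set) : Set where
  open CommutativeRing R
  field
    resp : ∀ {a b} → a ≈ b → P a → P b
    0∈   : P 0#
    1∈   : P 1#
    +∈   : ∀ {a b} → P a → P b → P (a + b)
    *∈   : ∀ {a b} → P a → P b → P (a * b)
    -∈   : ∀ {a} → P a → P (- a)

module Sums (R : CommutativeRing 0ℓ 0ℓ) where
  open CommutativeRing R hiding (zero) renaming (refl to ≈-refl; sym to ≈-sym; trans to ≈-trans)
  open SemiringSolver commutativeSemiring using (solve; _:=_; _:+_)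
  open import Relation.Binary.Reasoning.Setoid setoid

  ∑ : List A → (A → Carrier) → Carrier
  ∑ []       f = 0#
  ∑ (x ∷ xs) f = f x + ∑ xs f

  ∑-cong∈ : (xs : List A) {f g : A → Carrier} → (∀ {x} → x ∈ xs → f x ≈ g x) → ∑ xs f ≈ ∑ xs g
  ∑-cong∈ []       e = ≈-refl
  ∑-cong∈ (x ∷ xs) e = +-cong (e (here refl)) (∑-cong∈ xs (e ∘ there))

  ∑-cong : (xs : List A) {f g : A → Carrier} → (∀ x → f x ≈ g x) → ∑ xs f ≈ ∑ xs g
  ∑-cong xs e = ∑-cong∈ xs (λ {x} _ → e x)

  ∑-0 : (xs : List A) → ∑ xs (λ _ → 0#) ≈ 0#
  ∑-0 []       = ≈-refl
  ∑-0 (x ∷ xs) = ≈-trans (+-identityˡ _) (∑-0 xs)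

  ∑-+ : (xs : List A) (f g : A → Carrier) → ∑ xs (λ x → f x + g x) ≈ ∑ xs f + ∑ xs g
  ∑-+ []       f g = ≈-sym (+-identityˡ _)
  ∑-+ (x ∷ xs) f g = ≈-trans (+-congˡ (∑-+ xs f g))
    (solve 4 (λ a b c d → (a :+ b) :+ (c :+ d) := (a :+ c) :+ (b :+ d)) ≈-refl _ _ _ _)

  ∑-*ˡ : (xs : List A) (a : Carrier) (f : A → Carrier) → a * ∑ xs f ≈ ∑ xs (λ x → a * f x)
  ∑-*ˡ []       a f = zeroʳ a
  ∑-*ˡ (x ∷ xs) a f = ≈-trans (distribˡ a _ _) (+-congˡ (∑-*ˡ xs a f))

  ∑-*ʳ : (xs : List A) (a : Carrier) (f : A → Carrier) → ∑ xs f * a ≈ ∑ xs (λ x → f x * a)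
  ∑-*ʳ xs a f = ≈-trans (*-comm _ a) (≈-trans (∑-*ˡ xs a f) (∑-cong xs (λ x → *-comm a (f x))))

  ∑-++ : (xs ys : List A) (f : A → Carrier) → ∑ (xs ++ ys) f ≈ ∑ xs f + ∑ ys f
  ∑-++ []       ys f = ≈-sym (+-identityˡ _)
  ∑-++ (x ∷ xs) ys f = ≈-trans (+-congˡ (∑-++ xs ys f)) (≈-sym (+-assoc _ _ _))

  ∑-map : (h : B → A) (ys : List B) (f : A → Carrier) → ∑ (map h ys) f ≈ ∑ ys (f ∘ h)
  ∑-map h []       f = ≈-refl
  ∑-map h (y ∷ ys) f = +-congˡ (∑-map h ys f)

  ∑-concatMap : (h : B → List A) (ys : List B) (f : A → Carrier) →
                ∑ (concatMap h ys) f ≈ ∑ ys (λ y → ∑ (h y) f)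
  ∑-concatMap h []       f = ≈-refl
  ∑-concatMap h (y ∷ ys) f = ≈-trans (∑-++ (h y) _ f) (+-congˡ (∑-concatMap h ys f))

  ∑-swap : (xs : List A) (ys : List B) (f : A → B → Carrier) →
           ∑ xs (λ x → ∑ ys (f x)) ≈ ∑ ys (λ y → ∑ xs (λ x → f x y))
  ∑-swap []       ys f = ≈-sym (∑-0 ys)
  ∑-swap (x ∷ xs) ys f = ≈-trans (+-congˡ (∑-swap xs ys f)) (≈-sym (∑-+ ys (f x) _))

  module _ {P : Carrier → Set} (sub : IsSubring R P) where
    open IsSubring sub

    ∑∈ : (xs : List A) {f : A → Carrier} → (∀ {x} → x ∈ xs → P (f x)) → P (∑ xs f)
    ∑∈ []       p = 0∈
    ∑∈ (x ∷ xs) p = +∈ (p (here refl)) (∑∈ xs (p ∘ there))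

module PowerSeries (R : CommutativeRing 0ℓ 0ℓ) where
  open CommutativeRing R hiding (zero) renaming (refl to ≈-refl; sym to ≈-sym; trans to ≈-trans)
  open SemiringSolver commutativeSemiring using (solve; _:=_; _:+_; _:*_)
  open Sums R
  open import Relation.Binary.Reasoning.Setoid setoid

  Series : Set
  Series = ℕ → Carrier

  infix  4 _≋_
  infixl 7 _⊛_

  _≋_ : Series → Series → Set
  f ≋ g = ∀ n → f n ≈ g n

  -- The Cauchy product, defined by splitting off the constant term of the left factor, which turns
  -- the ring laws into inductions on the degree. The sum over i + j = n comes back only in `⊛-upTo`
  -- and, for integer coefficients, in `⊛-sumTo`.
  _⊛_ : Series → Series → Series
  (f ⊛ g) zero    = f 0 * g 0
  (f ⊛ g) (suc n) = f 0 * g (suc n) + ((f ∘ suc) ⊛ g) n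

  const : Carrier → Series
  const a zero    = a
  const a (suc _) = 0#

  X : Series
  X zero    = 0#
  X (suc n) = const 1# n

  ⊛-cong : ∀ {f f′ g g′} → f ≋ f′ → g ≋ g′ → f ⊛ g ≋ f′ ⊛ g′
  ⊛-cong e e′ zero    = *-cong (e 0) (e′ 0)
  ⊛-cong e e′ (suc n) = +-cong (*-cong (e 0) (e′ (suc n))) (⊛-cong (e ∘ suc) e′ n)

  ⊛-zeroˡ : ∀ g → (λ _ → 0#) ⊛ g ≋ (λ _ → 0#)
  ⊛-zeroˡ g zero    = zeroˡ _
  ⊛-zeroˡ g (suc n) = ≈-trans (+-cong (zeroˡ _) (⊛-zeroˡ g n)) (+-identityˡ _)

  const-⊛ : ∀ a g → const a ⊛ g ≋ (λ n → a * g n)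
  const-⊛ a g zero    = ≈-refl
  const-⊛ a g (suc n) = ≈-trans (+-congˡ (⊛-zeroˡ g n)) (+-identityʳ _)

  X-⊛-suc : ∀ g n → (X ⊛ g) (suc n) ≈ g n
  X-⊛-suc g n = ≈-trans (+-congʳ (zeroˡ _)) (≈-trans (+-identityˡ _) (≈-trans (const-⊛ 1# g n) (*-identityˡ _)))

  head-tail : ∀ f → f ≋ (λ n → const (f 0) n + (X ⊛ (f ∘ suc)) n)
  head-tail f zero    = ≈-sym (≈-trans (+-congˡ (zeroˡ _)) (+-identityʳ _))
  head-tail f (suc n) = ≈-sym (≈-trans (+-identityˡ _) (X-⊛-suc (f ∘ suc) n))

  ⊛-scale : ∀ a f g → (λ n → a * f n) ⊛ g ≋ (λ n → a * (f ⊛ g) n)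
  ⊛-scale a f g zero    = *-assoc a _ _
  ⊛-scale a f g (suc n) = ≈-trans (+-cong (*-assoc a _ _) (⊛-scale a (f ∘ suc) g n)) (≈-sym (distribˡ a _ _))

  ⊛-distribʳ : ∀ h f g → (λ n → f n + g n) ⊛ h ≋ (λ n → (f ⊛ h) n + (g ⊛ h) n)
  ⊛-distribʳ h f g zero    = distribʳ _ _ _
  ⊛-distribʳ h f g (suc n) = ≈-trans (+-congˡ (⊛-distribʳ h (f ∘ suc) (g ∘ suc) n))
    (solve 5 (λ a b c d e → (a :+ b) :* c :+ (d :+ e) := (a :* c :+ d) :+ (b :* c :+ e)) ≈-refl _ _ _ _ _)

  -- Splitting off the constant term of the right factor instead gives the mirror image of the
  -- defining recursion; commutativity compares the two.
  ⊛-suc′ : ∀ f g n → (f ⊛ g) (suc n) ≈ f (suc n) * g 0 + (f ⊛ (g ∘ suc)) n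
  ⊛-suc′ f g zero    = +-comm _ _
  ⊛-suc′ f g (suc n) = ≈-trans (+-congˡ (⊛-suc′ (f ∘ suc) g n))
    (solve 3 (λ a b c → a :+ (b :+ c) := b :+ (a :+ c)) ≈-refl _ _ _)

  ⊛-comm : ∀ f g → f ⊛ g ≋ g ⊛ f
  ⊛-comm f g zero    = *-comm _ _
  ⊛-comm f g (suc n) = ≈-trans (+-cong (*-comm _ _) (⊛-comm (f ∘ suc) g n)) (≈-sym (⊛-suc′ g f n))

  ⊛-assoc : ∀ f g h → (f ⊛ g) ⊛ h ≋ f ⊛ (g ⊛ h)
  ⊛-assoc f g h zero    = *-assoc _ _ _
  ⊛-assoc f g h (suc n) = begin
    f 0 * g 0 * h (suc n) + ((λ m → f 0 * g (suc m) + ((f ∘ suc) ⊛ g) m) ⊛ h) n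
      ≈⟨ +-congˡ (⊛-distribʳ h (λ m → f 0 * g (suc m)) ((f ∘ suc) ⊛ g) n) ⟩
    f 0 * g 0 * h (suc n) + (((λ m → f 0 * g (suc m)) ⊛ h) n + (((f ∘ suc) ⊛ g) ⊛ h) n)
      ≈⟨ +-congˡ (+-cong (⊛-scale (f 0) (g ∘ suc) h n) (⊛-assoc (f ∘ suc) g h n)) ⟩
    f 0 * g 0 * h (suc n) + (f 0 * ((g ∘ suc) ⊛ h) n + ((f ∘ suc) ⊛ (g ⊛ h)) n)
      ≈⟨ solve 5 (λ a b c d e → a :* b :* c :+ (a :* d :+ e) := a :* (b :* c :+ d) :+ e) ≈-refl _ _ _ _ _ ⟩
    f 0 * (g 0 * h (suc n) + ((g ∘ suc) ⊛ h) n) + ((f ∘ suc) ⊛ (g ⊛ h)) n ∎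

  series : CommutativeRing 0ℓ 0ℓ
  series = record
    { Carrier = Series
    ; _≈_ = _≋_
    ; _+_ = λ f g n → f n + g n
    ; _*_ = _⊛_
    ; -_  = λ f n → - f n
    ; 0#  = λ _ → 0#
    ; 1#  = const 1#
    ; isCommutativeRing = record
      { isRing = record
        { +-isAbelianGroup = record
          { isGroup = record
            { isMonoid = record
              { isSemigroup = record
                { isMagma = record
                  { isEquivalence = record
                    { refl  = λ _ → ≈-refl
                    ; sym   = λ e n → ≈-sym (e n)
                    ; trans = λ e e′ n → ≈-trans (e n) (e′ n) }
                  ; ∙-cong = λ e e′ n → +-cong (e n) (e′ n) }
                ; assoc = λ f g h n → +-assoc _ _ _ }
              ; identity = (λ f n → +-identityˡ _) , (λ f n → +-identityʳ _) }
            ; inverse = (λ f n → -‿inverseˡ _) , (λ f n → -‿inverseʳ _)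
            ; ⁻¹-cong = λ e n → -‿cong (e n) }
          ; comm = λ f g n → +-comm _ _ }
        ; *-cong = ⊛-cong
        ; *-assoc = ⊛-assoc
        ; *-identity = 1-⊛ , (λ f n → ≈-trans (⊛-comm f (const 1#) n) (1-⊛ f n))
        ; distrib = (λ f g h n → ≈-trans (⊛-comm f _ n) (≈-trans (⊛-distribʳ f g h n)
                                   (+-cong (⊛-comm g f n) (⊛-comm h f n))))
                  , ⊛-distribʳ }
      ; *-comm = ⊛-comm }
    }
    where
    1-⊛ : ∀ f → const 1# ⊛ f ≋ f
    1-⊛ f n = ≈-trans (const-⊛ 1# f n) (*-identityˡ _)

  ∑-coeff : {Y : Set} (ys : List Y) (f : Y → Series) (n : ℕ) →
            Sums.∑ series ys f n ≈ ∑ ys (λ y → f y n)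
  ∑-coeff []       f n = ≈-refl
  ∑-coeff (y ∷ ys) f n = +-congˡ (∑-coeff ys f n)

  ⊛-upTo : ∀ f g n → (f ⊛ g) n ≈ ∑ (upTo (suc n)) (λ i → f i * g (n ℕ.∸ i))
  ⊛-upTo f g zero    = ≈-sym (+-identityʳ _)
  ⊛-upTo f g (suc n) = +-congˡ (≈-trans (⊛-upTo (f ∘ suc) g n)
    (≈-trans (≈-sym (∑-map suc (upTo (suc n)) _))
      (reflexive (≡.cong (λ l → ∑ l (λ i → f i * g (suc n ℕ.∸ i))) (map-upTo suc (suc n))))))

  -- Used twice: over the integers for polynomials in t, then over series in t for polynomials in x
  -- whose coefficients are polynomials in t. The bound N can be any point from which on all
  -- coefficients vanish.
  IsPoly : (Carrier → Set) → Series → Set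
  IsPoly P f = (∀ n → P (f n)) × ∃ λ N → ∀ n → N ≤ n → f n ≈ 0#

  module _ {P : Carrier → Set} (sub : IsSubring R P) where
    open IsSubring sub
    open RingProperties ring using (-0#≈0#)

    private
      ⊛∈ : ∀ {f g} → (∀ n → P (f n)) → (∀ n → P (g n)) → ∀ n → P ((f ⊛ g) n)
      ⊛∈ p q zero    = *∈ (p 0) (q 0)
      ⊛∈ p q (suc n) = +∈ (*∈ (p 0) (q (suc n))) (⊛∈ (p ∘ suc) q n)

      ⊛-degree : ∀ N M f g → (∀ n → N ≤ n → f n ≈ 0#) → (∀ n → M ≤ n → g n ≈ 0#) →
                 ∀ n → N ℕ.+ M ≤ n → (f ⊛ g) n ≈ 0#
      ⊛-degree zero    M f g p q n _ = ≈-trans (⊛-cong {g = g} (λ i → p i z≤n) (λ _ → ≈-refl) n) (⊛-zeroˡ g n)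
      ⊛-degree (suc N) M f g p q (suc n) (s≤s le) =
        ≈-trans (+-cong (≈-trans (*-congˡ (q (suc n) (ℕ.m≤n⇒m≤1+n (ℕ.≤-trans (ℕ.m≤n+m M N) le)))) (zeroʳ _))
                      (⊛-degree N M (f ∘ suc) g (λ i → p (suc i) ∘ s≤s) q n le))
              (+-identityˡ _)

    const-poly : ∀ {a} → P a → IsPoly P (const a)
    const-poly p = (λ { zero → p ; (suc _) → 0∈ }) , 1 , λ { (suc _) (s≤s _) → ≈-refl }

    X-poly : IsPoly P X
    X-poly = (λ { zero → 0∈ ; (suc n) → proj₁ (const-poly 1∈) n }) , 2 ,
      λ { (suc (suc _)) (s≤s (s≤s _)) → ≈-refl }

    polySubring : IsSubring series (IsPoly P)
    polySubring = record
      { resp = λ e (p , N , z) → (λ n → resp (e n) (p n)) , N , λ n le → ≈-trans (≈-sym (e n)) (z n le)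
      ; 0∈ = (λ _ → 0∈) , 0 , λ _ _ → ≈-refl
      ; 1∈ = const-poly 1∈
      ; +∈ = λ (p , N , z) (q , M , w) → (λ n → +∈ (p n) (q n)) , N ℕ.+ M , λ n le →
          ≈-trans (+-cong (z n (ℕ.≤-trans (ℕ.m≤m+n N M) le)) (w n (ℕ.≤-trans (ℕ.m≤n+m M N) le))) (+-identityˡ _)
      ; *∈ = λ {f} {g} (p , N , z) (q , M , w) → ⊛∈ p q , N ℕ.+ M , ⊛-degree N M f g z w
      ; -∈ = λ (p , N , z) → (λ n → -∈ (p n)) , N , λ n le → ≈-trans (-‿cong (z n le)) -0#≈0# }

-- Fractions with denominators 1 + x u, and linear systems

module Fractions (R : CommutativeRing 0ℓ 0ℓ) {P : CommutativeRing.Carrier R → Set}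
                 (sub : IsSubring R P) (x : CommutativeRing.Carrier R) (x∈ : P x) where
  open CommutativeRing R hiding (zero) renaming (refl to ≈-refl; sym to ≈-sym; trans to ≈-trans)
  open IsSubring sub
  open Sums R
  open SemiringSolver commutativeSemiring using (solve; _:=_; _:+_; _:*_; con)
  open GroupProperties +-group using () renaming (∙-cancelʳ to +-cancelʳ)
  open import Relation.Binary.Reasoning.Setoid setoid

  Denominator : Carrier → Set
  Denominator q = ∃ λ u → P u × q ≈ 1# + x * u

  -- No field of fractions is formed: f stays a power series and some denominator clears it.
  -- Denominators lie in `P` and are closed under products, which is what the arithmetic below
  -- relies on.
  Rat : Carrier → Set
  Rat f = ∃ λ q → Denominator q × P (q * f)

  denominator∈ : ∀ {q} → Denominator q → P q
  denominator∈ (u , u∈ , e) = resp (≈-sym e) (+∈ 1∈ (*∈ x∈ u∈))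

  1-denominator : Denominator 1#
  1-denominator = 0# , 0∈ , ≈-sym (≈-trans (+-congˡ (zeroʳ x)) (+-identityʳ _))

  *-denominator : ∀ {q r} → Denominator q → Denominator r → Denominator (q * r)
  *-denominator (u , u∈ , e) (v , v∈ , e′) = u + v + x * (u * v) , +∈ (+∈ u∈ v∈) (*∈ x∈ (*∈ u∈ v∈)) ,
    ≈-trans (*-cong e e′) (solve 3 (λ x u v → (con 1 :+ x :* u) :* (con 1 :+ x :* v)
                                      := con 1 :+ x :* (u :+ v :+ x :* (u :* v))) ≈-refl x u v)

  rat-resp : ∀ {f g} → f ≈ g → Rat f → Rat g
  rat-resp e (q , d , p) = q , d , resp (*-congˡ e) p

  rat-∈ : ∀ {f} → P f → Rat f
  rat-∈ p = 1# , 1-denominator , resp (≈-sym (*-identityˡ _)) p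

  rat-quotient : ∀ {q f} → Denominator q → Rat (q * f) → Rat f
  rat-quotient {q} d (r , d′ , p) = r * q , *-denominator d′ d , resp (≈-sym (*-assoc r q _)) p

  rat-+ : ∀ {f g} → Rat f → Rat g → Rat (f + g)
  rat-+ {f} {g} (q , d , p) (r , d′ , p′) = q * r , *-denominator d d′ ,
    resp (solve 4 (λ q r f g → r :* (q :* f) :+ q :* (r :* g) := q :* r :* (f :+ g)) ≈-refl q r f g)
         (+∈ (*∈ (denominator∈ d′) p) (*∈ (denominator∈ d) p′))

  rat-* : ∀ {f g} → Rat f → Rat g → Rat (f * g)
  rat-* {f} {g} (q , d , p) (r , d′ , p′) = q * r , *-denominator d d′ ,
    resp (solve 4 (λ q r f g → (q :* f) :* (r :* g) := q :* r :* (f :* g)) ≈-refl q r f g) (*∈ p p′)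

  rat-∑ : {Y : Set} (ys : List Y) {f : Y → Carrier} → (∀ {y} → y ∈ ys → Rat (f y)) → Rat (∑ ys f)
  rat-∑ []       r = rat-∈ 0∈
  rat-∑ (y ∷ ys) r = rat-+ (r (here refl)) (rat-∑ ys (r ∘ there))

  module _ {Y : Set} (y : Y → Carrier) where

    -- Nested form of f = p + x (sum of m_j y_j over the list), with p and all m_j in `P`. With the
    -- factor x built in, moving an unknown to the left changes a denominator only by a multiple of
    -- x.
    Affine : List Y → Carrier → Set
    Affine []       f = P f
    Affine (j ∷ js) f = ∃ λ m → ∃ λ g → P m × Affine js g × f ≈ x * (m * y j) + g

    affine-resp : ∀ L {f g} → f ≈ g → Affine L f → Affine L g
    affine-resp []      e p = resp e p
    affine-resp (_ ∷ _) e (m , h , m∈ , a , e′) = m , h , m∈ , a , ≈-trans (≈-sym e) e′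

    affine-const : ∀ L {f} → P f → Affine L f
    affine-const []       p = p
    affine-const (j ∷ js) {f} p = 0# , f , 0∈ , affine-const js p ,
      solve 3 (λ x y f → f := x :* (con 0 :* y) :+ f) ≈-refl x (y j) f

    affine-+ : ∀ L {f g} → Affine L f → Affine L g → Affine L (f + g)
    affine-+ []       p q = +∈ p q
    affine-+ (j ∷ js) (m , h , m∈ , a , e) (m′ , h′ , m∈′ , a′ , e′) =
      m + m′ , h + h′ , +∈ m∈ m∈′ , affine-+ js a a′ , ≈-trans (+-cong e e′)
        (solve 6 (λ x m m′ y h h′ → (x :* (m :* y) :+ h) :+ (x :* (m′ :* y) :+ h′)
                     := x :* ((m :+ m′) :* y) :+ (h :+ h′)) ≈-refl x m m′ (y j) h h′)

    affine-* : ∀ L {a f} → P a → Affine L f → Affine L (a * f)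
    affine-* []       a∈ p = *∈ a∈ p
    affine-* (j ∷ js) {a} a∈ (m , h , m∈ , r , e) = a * m , a * h , *∈ a∈ m∈ , affine-* js a∈ r ,
      ≈-trans (*-congˡ e) (solve 5 (λ a x m y h → a :* (x :* (m :* y) :+ h)
                                   := x :* (a :* m :* y) :+ a :* h) ≈-refl a x m (y j) h)

    affine-var : ∀ L {j} → j ∈ L → Affine L (x * y j)
    affine-var (j ∷ js) (here refl) = 1# , 0# , 1∈ , affine-const js 0∈ ,
      solve 2 (λ x y → x :* y := x :* (con 1 :* y) :+ con 0) ≈-refl x (y j)
    affine-var (j ∷ js) {i} (there i∈) = 0# , x * y i , 0∈ , affine-var js i∈ ,
      solve 3 (λ x y f → f := x :* (con 0 :* y) :+ f) ≈-refl x (y j) (x * y i)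

    affine-∑ : ∀ L {Z : Set} (zs : List Z) {f : Z → Carrier} → (∀ {z} → z ∈ zs → Affine L (f z)) →
               Affine L (∑ zs f)
    affine-∑ L []       a = affine-const L 0∈
    affine-∑ L (z ∷ zs) a = affine-+ L (a (here refl)) (affine-∑ L zs (a ∘ there))

    affine⇒rat : ∀ L → (∀ {j} → j ∈ L → Rat (y j)) → ∀ {f} → Affine L f → Rat f
    affine⇒rat []       r p = rat-∈ p
    affine⇒rat (j ∷ js) r (m , g , m∈ , a , e) = rat-resp (≈-sym e)
      (rat-+ (rat-* (rat-∈ x∈) (rat-* (rat-∈ m∈) (r (here refl)))) (affine⇒rat js (r ∘ there) a))

    -- Gaussian elimination of y j from the system.
    solve-system : ∀ L {q} → Denominator q → (∀ {j} → j ∈ L → Affine L (q * y j)) →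
                   ∀ {j} → j ∈ L → Rat (y j)
    solve-system (j ∷ js) {q} (u , u∈ , e) sys with sys (here refl)
    ... | m , g , m∈ , a , eq = λ where
        -- Back substitution: `d * y j` is affine in the other unknowns, and these are rational by
        -- the recursive call.
        (here refl) → rat-quotient d-den (affine⇒rat js others (affine-resp js (≈-sym dy) a))
        (there i∈)    → others i∈
      where
      -- The pivot: in q y_j = x m y_j + g the term x m y_j goes to the left. As q = 1 + x u, the
      -- pivot is 1 + x (u - m), again a denominator.
      d : Carrier
      d = q + - (x * m)

      d-split : q ≈ d + x * m
      d-split = ≈-sym (≈-trans (+-assoc _ _ _) (≈-trans (+-congˡ (-‿inverseˡ _)) (+-identityʳ _)))

      d-den : Denominator d
      d-den = u + - m , +∈ u∈ (-∈ m∈) , +-cancelʳ (x * m) d (1# + x * (u + - m)) (begin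
        d + x * m                        ≈⟨ d-split ⟨
        q                                ≈⟨ e ⟩
        1# + x * u                       ≈⟨ +-congˡ (*-congˡ (≈-trans (+-congˡ (-‿inverseˡ m)) (+-identityʳ u))) ⟨
        1# + x * (u + (- m + m))         ≈⟨ solve 4 (λ x u v m → con 1 :+ x :* (u :+ (v :+ m))
                                              := con 1 :+ x :* (u :+ v) :+ x :* m) ≈-refl x u (- m) m ⟩
        1# + x * (u + - m) + x * m       ∎)

      dy : d * y j ≈ g
      dy = +-cancelʳ (x * (m * y j)) (d * y j) g (begin
        d * y j + x * (m * y j) ≈⟨ solve 4 (λ d x m y → d :* y :+ x :* (m :* y) := (d :+ x :* m) :* y)
                                     ≈-refl d x m (y j) ⟩
        (d + x * m) * y j       ≈⟨ *-congʳ d-split ⟨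
        q * y j                 ≈⟨ eq ⟩
        x * (m * y j) + g       ≈⟨ +-comm _ _ ⟩
        g + x * (m * y j)       ∎)

      -- Row i is multiplied by d, and d y_j is replaced by g, so y_j disappears. All remaining rows
      -- then share the left factor d q; this is why the system is stated with a common factor q.
      others : ∀ {i} → i ∈ js → Rat (y i)
      others = solve-system js (*-denominator d-den (u , u∈ , e)) eliminate
        where
        eliminate : ∀ {i} → i ∈ js → Affine js (d * q * y i)
        eliminate {i} i∈ with sys (there i∈)
        ... | m′ , g′ , m∈′ , a′ , eq′ =
          affine-resp js (begin
            x * m′ * g + d * g′                 ≈⟨ +-congʳ (*-congˡ dy) ⟨
            x * m′ * (d * y j) + d * g′         ≈⟨ solve 5 (λ x m d y g → x :* m :* (d :* y) :+ d :* g
                                                     := d :* (x :* (m :* y) :+ g)) ≈-refl x m′ d (y j) g′ ⟩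
            d * (x * (m′ * y j) + g′)           ≈⟨ *-congˡ eq′ ⟨
            d * (q * y i)                       ≈⟨ *-assoc d q (y i) ⟨
            d * q * y i                         ∎)
            (affine-+ js (affine-* js (*∈ x∈ m∈′) a) (affine-* js (denominator∈ d-den) a′))

-- Colorings

Coloring : Set → Set
Coloring A = List (A × Bool)

relabel : (B → A) → Coloring B → Coloring A
relabel g = map (map₁ g)

-- The number of black neighbours modulo 2, where r is a row of the adjacency matrix. It is additive
-- both in the coloring (`parity-++`) and in the row (`parity-xor`).
parity : (A → Bool) → Coloring A → Bool
parity r []            = false
parity r ((u , b) ∷ c) = (b ∧ r u) xor parity r c

parity-cong : {r r′ : A → Bool} → (∀ v → r v ≡ r′ v) → ∀ c → parity r c ≡ parity r′ c
parity-cong e []            = refl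
parity-cong e ((u , b) ∷ c) = cong₂ (λ x y → (b ∧ x) xor y) (e u) (parity-cong e c)

parity-++ : (r : A → Bool) (c d : Coloring A) → parity r (c ++ d) ≡ parity r c xor parity r d
parity-++ r []            d = refl
parity-++ r ((u , b) ∷ c) d =
  ≡.trans (cong ((b ∧ r u) xor_) (parity-++ r c d)) (≡.sym (xor-assoc (b ∧ r u) _ _))

parity-relabel : (r : A → Bool) (g : B → A) (c : Coloring B) → parity r (relabel g c) ≡ parity (r ∘ g) c
parity-relabel r g []            = refl
parity-relabel r g ((u , b) ∷ c) = cong ((b ∧ r (g u)) xor_) (parity-relabel r g c)

parity-false : (c : Coloring A) → parity (λ _ → false) c ≡ false
parity-false []                = refl
parity-false ((u , true) ∷ c)  = parity-false c
parity-false ((u , false) ∷ c) = parity-false c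

parity-xor : (r s : A → Bool) (c : Coloring A) → parity (λ v → r v xor s v) c ≡ parity r c xor parity s c
parity-xor r s []            = refl
parity-xor r s ((u , b) ∷ c) = ≡.trans (cong ((b ∧ (r u xor s u)) xor_) (parity-xor r s c))
  (solve 5 (λ b x y p q → b :* (x :+ y) :+ (p :+ q) := (b :* x :+ p) :+ (b :* y :+ q)) refl b (r u) (s u) _ _)
  where open xor-∧-Solver

parity-∧ : (a : Bool) (r : A → Bool) (c : Coloring A) → parity (λ v → a ∧ r v) c ≡ a ∧ parity r c
parity-∧ true  r c = refl
parity-∧ false r c = parity-false c

parity-↭ : (r : A → Bool) {c d : Coloring A} → c ↭ d → parity r c ≡ parity r d
parity-↭ r ↭.refl               = refl
parity-↭ r (↭.prep (u , b) p)   = cong ((b ∧ r u) xor_) (parity-↭ r p)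
parity-↭ r (↭.swap {ys = d} (u , b) (v , b′) p) =
  ≡.trans (cong (λ z → (b ∧ r u) xor ((b′ ∧ r v) xor z)) (parity-↭ r p))
    (solve 3 (λ x y z → x :+ (y :+ z) := y :+ (x :+ z)) refl (b ∧ r u) (b′ ∧ r v) (parity r d))
  where open xor-∧-Solver
parity-↭ r (↭.trans p q)        = ≡.trans (parity-↭ r p) (parity-↭ r q)

module Weights (R : CommutativeRing 0ℓ 0ℓ) (t : CommutativeRing.Carrier R) where
  open CommutativeRing R hiding (zero) renaming (refl to ≈-refl; sym to ≈-sym; trans to ≈-trans)
  open SemiringSolver commutativeSemiring using (solve; _:=_; _:+_; _:*_)
  open Sums R
  open import Relation.Binary.Reasoning.Setoid setoid

  weight : Bool → Bool → Carrier
  weight b p = if b ∨ p then 1# else t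

  -- r v stands for the parity of the number of black neighbours of v.
  Φ : Coloring A → (A → Bool) → Carrier
  Φ []            r = 1#
  Φ ((v , b) ∷ c) r = weight b (r v) * Φ c r

  Φ-cong : (c : Coloring A) {r r′ : A → Bool} → (∀ v → r v ≡ r′ v) → Φ c r ≈ Φ c r′
  Φ-cong []            e = ≈-refl
  Φ-cong ((v , b) ∷ c) e = *-cong (reflexive (cong (weight b) (e v))) (Φ-cong c e)

  Φ-++ : (c d : Coloring A) (r : A → Bool) → Φ (c ++ d) r ≈ Φ c r * Φ d r
  Φ-++ []      d r = ≈-sym (*-identityˡ _)
  Φ-++ (_ ∷ c) d r = ≈-trans (*-congˡ (Φ-++ c d r)) (≈-sym (*-assoc _ _ _))

  Φ-relabel : (g : B → A) (c : Coloring B) (r : A → Bool) → Φ (relabel g c) r ≈ Φ c (r ∘ g)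
  Φ-relabel g []      r = ≈-refl
  Φ-relabel g (_ ∷ c) r = *-congˡ (Φ-relabel g c r)

  Φ-↭ : {c d : Coloring A} → c ↭ d → (r : A → Bool) → Φ c r ≈ Φ d r
  Φ-↭ ↭.refl         r = ≈-refl
  Φ-↭ (↭.prep x p)   r = *-congˡ (Φ-↭ p r)
  Φ-↭ (↭.swap x y p) r = ≈-trans (*-congˡ (*-congˡ (Φ-↭ p r)))
    (solve 3 (λ a b c → a :* (b :* c) := b :* (a :* c)) ≈-refl _ _ _)
  Φ-↭ (↭.trans p q)  r = ≈-trans (Φ-↭ p r) (Φ-↭ q r)

  module _ {P : Carrier → Set} (sub : IsSubring R P) (t∈ : P t) where
    open IsSubring sub

    weight∈ : ∀ b p → P (weight b p)
    weight∈ true  p     = 1∈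
    weight∈ false true  = 1∈
    weight∈ false false = t∈

    Φ∈ : (c : Coloring A) (r : A → Bool) → P (Φ c r)
    Φ∈ []            r = 1∈
    Φ∈ ((v , b) ∷ c) r = *∈ (weight∈ b (r v)) (Φ∈ c r)

  ∑-colorings-∷ : (v : A) (vs : List A) (f : Coloring A → Carrier) →
    ∑ (colorings (v ∷ vs)) f ≈ ∑ (colorings vs) (λ c → f ((v , false) ∷ c) + f ((v , true) ∷ c))
  ∑-colorings-∷ v vs f = ≈-trans (∑-concatMap _ (colorings vs) f)
    (∑-cong (colorings vs) (λ c → +-congˡ (+-identityʳ _)))

  ∑-colorings-++ : (us vs : List A) (f : Coloring A → Carrier) →
    ∑ (colorings (us ++ vs)) f ≈ ∑ (colorings us) (λ c → ∑ (colorings vs) (λ d → f (c ++ d)))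
  ∑-colorings-++ []       vs f = ≈-sym (+-identityʳ _)
  ∑-colorings-++ (u ∷ us) vs f = begin
    ∑ (colorings (u ∷ us ++ vs)) f
      ≈⟨ ∑-colorings-∷ u (us ++ vs) f ⟩
    ∑ (colorings (us ++ vs)) (λ c → f ((u , false) ∷ c) + f ((u , true) ∷ c))
      ≈⟨ ∑-colorings-++ us vs _ ⟩
    ∑ (colorings us) (λ c → ∑ (colorings vs) (λ d → f ((u , false) ∷ c ++ d) + f ((u , true) ∷ c ++ d)))
      ≈⟨ ∑-cong (colorings us) (λ c → ∑-+ (colorings vs) _ _) ⟩
    ∑ (colorings us) (λ c → ∑ (colorings vs) (λ d → f ((u , false) ∷ c ++ d))
                          + ∑ (colorings vs) (λ d → f ((u , true) ∷ c ++ d)))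
      ≈⟨ ∑-colorings-∷ u us _ ⟨
    ∑ (colorings (u ∷ us)) (λ c → ∑ (colorings vs) (λ d → f (c ++ d))) ∎

  ∑-colorings-map : (g : B → A) (us : List B) (f : Coloring A → Carrier) →
    ∑ (colorings (map g us)) f ≈ ∑ (colorings us) (f ∘ relabel g)
  ∑-colorings-map g []       f = ≈-refl
  ∑-colorings-map g (u ∷ us) f = begin
    ∑ (colorings (g u ∷ map g us)) f  ≈⟨ ∑-colorings-∷ (g u) (map g us) f ⟩
    _                                 ≈⟨ ∑-colorings-map g us _ ⟩
    _                                 ≈⟨ ∑-colorings-∷ u us (f ∘ relabel g) ⟨
    ∑ (colorings (u ∷ us)) (f ∘ relabel g) ∎

  -- Reordering the vertices reorders each coloring as a list, so `f` has to ignore that order.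
  -- Exchanging two vertices transposes the two-by-two table of their colors. This allows passing
  -- from products listed column by column to chains listed layer by layer.
  ∑-colorings-↭ : {us vs : List A} → us ↭ vs → (f : Coloring A → Carrier) →
    (∀ {c d} → c ↭ d → f c ≈ f d) → ∑ (colorings us) f ≈ ∑ (colorings vs) f
  ∑-colorings-↭ ↭.refl f inv = ≈-refl
  ∑-colorings-↭ (↭.prep {xs = us} {ys = vs} v p) f inv = begin
    ∑ (colorings (v ∷ us)) f ≈⟨ ∑-colorings-∷ v us f ⟩
    _                        ≈⟨ ∑-colorings-↭ p _ (λ q → +-cong (inv (↭.prep _ q)) (inv (↭.prep _ q))) ⟩
    _                        ≈⟨ ∑-colorings-∷ v vs f ⟨
    ∑ (colorings (v ∷ vs)) f ∎
  ∑-colorings-↭ (↭.swap {xs = us} {ys = vs} u v p) f inv = begin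
    ∑ (colorings (u ∷ v ∷ us)) f ≈⟨ ∑-colorings-∷ u (v ∷ us) f ⟩
    _                            ≈⟨ ∑-colorings-∷ v us _ ⟩
    _                            ≈⟨ ∑-cong (colorings us) (λ c → interchange _ _ _ _
                                      (inv (↭.swap _ _ ↭.↭-refl)) (inv (↭.swap _ _ ↭.↭-refl))
                                      (inv (↭.swap _ _ ↭.↭-refl)) (inv (↭.swap _ _ ↭.↭-refl))) ⟩
    _                            ≈⟨ ∑-colorings-↭ p _ (λ q → +-cong
                                      (+-cong (inv (↭.prep _ (↭.prep _ q))) (inv (↭.prep _ (↭.prep _ q))))
                                      (+-cong (inv (↭.prep _ (↭.prep _ q))) (inv (↭.prep _ (↭.prep _ q))))) ⟩
    _                            ≈⟨ ∑-colorings-∷ u vs _ ⟨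
    _                            ≈⟨ ∑-colorings-∷ v (u ∷ vs) f ⟨
    ∑ (colorings (v ∷ u ∷ vs)) f ∎
    where
    interchange : ∀ a b c d {a′ b′ c′ d′} → a ≈ a′ → b ≈ b′ → c ≈ c′ → d ≈ d′ →
                  (a + b) + (c + d) ≈ (a′ + c′) + (b′ + d′)
    interchange a b c d e₁ e₂ e₃ e₄ = ≈-trans (+-cong (+-cong e₁ e₂) (+-cong e₃ e₄))
      (solve 4 (λ a b c d → (a :+ b) :+ (c :+ d) := (a :+ c) :+ (b :+ d)) ≈-refl _ _ _ _)
  ∑-colorings-↭ (↭.trans p q) f inv = ≈-trans (∑-colorings-↭ p f inv) (∑-colorings-↭ q f inv)

  W : (A → A → Bool) → List A → Carrier
  W a vs = ∑ (colorings vs) (λ c → Φ c (λ v → parity (a v) c))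

  W-cong : {a a′ : A → A → Bool} → (∀ u v → a u v ≡ a′ u v) → ∀ vs → W a vs ≈ W a′ vs
  W-cong e vs = ∑-cong (colorings vs) (λ c → Φ-cong c (λ v → parity-cong (e v) c))

  W-↭ : (a : A → A → Bool) {us vs : List A} → us ↭ vs → W a us ≈ W a vs
  W-↭ a p = ∑-colorings-↭ p _ (λ {c} {d} q →
    ≈-trans (Φ-cong c (λ v → parity-↭ (a v) q)) (Φ-↭ q (λ v → parity (a v) d)))

  W-map : (g : B → A) (a : A → A → Bool) (us : List B) → W a (map g us) ≈ W (λ u v → a (g u) (g v)) us
  W-map g a us = ≈-trans (∑-colorings-map g us _) (∑-cong (colorings us) (λ c →
    ≈-trans (Φ-relabel g c _) (Φ-cong c (λ u → parity-relabel (a (g u)) g c))))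

  W∈ : {P : Carrier → Set} (sub : IsSubring R P) → P t → (a : A → A → Bool) (vs : List A) → P (W a vs)
  W∈ sub t∈ a vs = ∑∈ sub (colorings vs) (λ {c} _ → Φ∈ sub t∈ c _)

-- Chains of layers

-- `ι i h` is the copy of h in layer i. With `ι ∘ suc` in the recursive call the tail of a chain is
-- again a chain numbered from 0; the inductions along chains rest on this shift.
layers : (ℕ → H → A) → List H → ℕ → List A
layers ι hs zero    = []
layers ι hs (suc k) = map (ι 0) hs ++ layers (ι ∘ suc) hs k

stack : (ℕ → H → A) → Vec (Coloring H) k → Coloring A
stack ι []       = []
stack ι (s ∷ ss) = relabel (ι 0) s ++ stack (ι ∘ suc) ss

end : H → Vec H k → H
end c []       = c
end c (s ∷ ss) = end s ss

stackParity : (ℕ → H → Bool) → Vec (Coloring H) k → Bool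
stackParity ρ []       = false
stackParity ρ (s ∷ ss) = parity (ρ 0) s xor stackParity (ρ ∘ suc) ss

parity-stack : (r : A → Bool) (ι : ℕ → H → A) (ss : Vec (Coloring H) k) →
               parity r (stack ι ss) ≡ stackParity (λ i h → r (ι i h)) ss
parity-stack r ι []       = refl
parity-stack r ι (s ∷ ss) = ≡.trans (parity-++ r (relabel (ι 0) s) _)
  (cong₂ _xor_ (parity-relabel r (ι 0) s) (parity-stack r (ι ∘ suc) ss))

stackParity-cong : {ρ ρ′ : ℕ → H → Bool} → (∀ i h → ρ i h ≡ ρ′ i h) →
                   (ss : Vec (Coloring H) k) → stackParity ρ ss ≡ stackParity ρ′ ss
stackParity-cong e []       = refl
stackParity-cong e (s ∷ ss) = cong₂ _xor_ (parity-cong (e 0) s) (stackParity-cong (e ∘ suc) ss)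

stackParity-false : (ss : Vec (Coloring H) k) → stackParity (λ _ _ → false) ss ≡ false
stackParity-false []       = refl
stackParity-false (s ∷ ss) = cong₂ _xor_ (parity-false s) (stackParity-false ss)

stackParity-xor : (ρ σ : ℕ → H → Bool) (ss : Vec (Coloring H) k) →
  stackParity (λ i h → ρ i h xor σ i h) ss ≡ stackParity ρ ss xor stackParity σ ss
stackParity-xor ρ σ []       = refl
stackParity-xor ρ σ (s ∷ ss) =
  ≡.trans (cong₂ _xor_ (parity-xor (ρ 0) (σ 0) s) (stackParity-xor (ρ ∘ suc) (σ ∘ suc) ss))
    (solve 4 (λ a b c d → (a :+ b) :+ (c :+ d) := (a :+ c) :+ (b :+ d)) refl
       (parity (ρ 0) s) (parity (σ 0) s) _ _)
  where open xor-∧-Solver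

stackParity-first : (r : H → Bool) (c : Coloring H) (ss : Vec (Coloring H) k) →
  stackParity (λ i h → (0 ≡ᵇ i) ∧ r h) (c ∷ ss) ≡ parity r c
stackParity-first r c ss = ≡.trans (cong (parity r c xor_) (stackParity-false ss)) (xor-identityʳ _)

-- `c ∷ ss` has k + 1 layers, so k is the index of the last one.
stackParity-last : (r : H → Bool) (c : Coloring H) (ss : Vec (Coloring H) k) →
  stackParity (λ i h → (i ≡ᵇ k) ∧ r h) (c ∷ ss) ≡ parity r (end c ss)
stackParity-last r c []       = xor-identityʳ _
stackParity-last r c (s ∷ ss) = cong₂ _xor_ (parity-false c) (stackParity-last r s ss)

module Chains (R : CommutativeRing 0ℓ 0ℓ) (t : CommutativeRing.Carrier R) where
  open CommutativeRing R hiding (zero) renaming (refl to ≈-refl; sym to ≈-sym; trans to ≈-trans)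
  open Sums R
  open Weights R t
  open import Relation.Binary.Reasoning.Setoid setoid

  stackΦ : Vec (Coloring H) k → (ℕ → H → Bool) → Carrier
  stackΦ []       ρ = 1#
  stackΦ (s ∷ ss) ρ = Φ s (ρ 0) * stackΦ ss (ρ ∘ suc)

  Φ-stack : (ι : ℕ → H → A) (ss : Vec (Coloring H) k) (r : A → Bool) →
            Φ (stack ι ss) r ≈ stackΦ ss (λ i h → r (ι i h))
  Φ-stack ι []       r = ≈-refl
  Φ-stack ι (s ∷ ss) r = ≈-trans (Φ-++ (relabel (ι 0) s) _ r)
    (*-cong (Φ-relabel (ι 0) s r) (Φ-stack (ι ∘ suc) ss r))

  module Chain {H : Set} (hs : List H) (inner link : H → H → Bool) where

    states : List (Coloring H)
    states = colorings hs

    sequences : (k : ℕ) → List (Vec (Coloring H) k)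
    sequences zero    = [] ∷ []
    sequences (suc k) = concatMap (λ s → map (s ∷_) (sequences k)) states

    ∑-sequences-suc : (k : ℕ) (f : Vec (Coloring H) (suc k) → Carrier) →
      ∑ (sequences (suc k)) f ≈ ∑ states (λ s → ∑ (sequences k) (λ ss → f (s ∷ ss)))
    ∑-sequences-suc k f = ≈-trans (∑-concatMap _ states f)
      (∑-cong states (λ s → ∑-map (s ∷_) (sequences k) f))

    ∑-colorings-layers : (ι : ℕ → H → A) (k : ℕ) (f : Coloring A → Carrier) →
      ∑ (colorings (layers ι hs k)) f ≈ ∑ (sequences k) (f ∘ stack ι)
    ∑-colorings-layers ι zero    f = ≈-refl
    ∑-colorings-layers ι (suc k) f = begin
      ∑ (colorings (map (ι 0) hs ++ layers (ι ∘ suc) hs k)) f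
        ≈⟨ ∑-colorings-++ (map (ι 0) hs) _ f ⟩
      ∑ (colorings (map (ι 0) hs)) (λ c → ∑ (colorings (layers (ι ∘ suc) hs k)) (λ d → f (c ++ d)))
        ≈⟨ ∑-colorings-map (ι 0) hs _ ⟩
      ∑ states (λ s → ∑ (colorings (layers (ι ∘ suc) hs k)) (λ d → f (relabel (ι 0) s ++ d)))
        ≈⟨ ∑-cong states (λ s → ∑-colorings-layers (ι ∘ suc) k _) ⟩
      ∑ states (λ s → ∑ (sequences k) (λ ss → f (stack ι (s ∷ ss))))
        ≈⟨ ∑-sequences-suc k (f ∘ stack ι) ⟨
      ∑ (sequences (suc k)) (f ∘ stack ι) ∎

    -- The weight of a layer colored c between layers colored p and q. A missing neighbour layer is
    -- the empty coloring, whose parity is `false`.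
    local : Coloring H → Coloring H → Coloring H → Carrier
    local p c q = Φ c (λ h → parity (link h) p xor (parity (inner h) c xor parity (link h) q))

    -- The weight of the last layer depends on what the chain is attached to, so it is left to
    -- `fin`, which receives the last two layers.
    run : Coloring H → Coloring H → Vec (Coloring H) k → (Coloring H → Coloring H → Carrier) → Carrier
    run p c []       fin = fin p c
    run p c (s ∷ ss) fin = local p c s * run c s ss fin

    -- A factor that depends only on the last layer travels through the product into `fin`. Thus the
    -- weight of the base graph, or the bits that a path shows to its ends, become part of the
    -- boundary term.
    run-* : ∀ p c (ss : Vec (Coloring H) k) fin (g : Coloring H → Carrier) →
            g (end c ss) * run p c ss fin ≈ run p c ss (λ p′ c′ → g c′ * fin p′ c′)
    run-* p c []       fin g = ≈-refl
    run-* p c (s ∷ ss) fin g = begin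
      g (end s ss) * (local p c s * run c s ss fin) ≈⟨ *-assoc _ _ _ ⟨
      g (end s ss) * local p c s * run c s ss fin   ≈⟨ *-congʳ (*-comm _ _) ⟩
      local p c s * g (end s ss) * run c s ss fin   ≈⟨ *-assoc _ _ _ ⟩
      local p c s * (g (end s ss) * run c s ss fin) ≈⟨ *-congˡ (run-* c s ss fin g) ⟩
      local p c s * run c s ss _                    ∎

    chainAdj : ℕ → H → ℕ → H → Bool
    chainAdj i h j h′ = ((i ≡ᵇ j) ∧ inner h h′) xor (((suc i ≡ᵇ j) ∨ (suc j ≡ᵇ i)) ∧ link h h′)

    -- The hypothesis lists the neighbours of layer i: the boundary p if i = 0, the boundary q if i
    -- = k, and the chain itself. The induction peels off the first layer, which then takes the
    -- place of p.
    stackΦ-chain : ∀ p c q (ss : Vec (Coloring H) k) (ρ : ℕ → H → Bool) →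
      (∀ i h → ρ i h ≡ (((0 ≡ᵇ i) ∧ parity (link h) p) xor ((i ≡ᵇ k) ∧ parity (link h) q))
                       xor stackParity (chainAdj i h) (c ∷ ss)) →
      stackΦ (c ∷ ss) ρ ≈ run p c ss (λ p′ c′ → local p′ c′ q)
    stackΦ-chain p c q [] ρ e = ≈-trans (*-identityʳ _) (Φ-cong c (λ h → ≡.trans (e 0 h)
      (≡.trans (cong ((parity (link h) p xor parity (link h) q) xor_)
                 (≡.trans (xor-identityʳ _) (parity-cong (λ h′ → xor-identityʳ (inner h h′)) c)))
        (solve 3 (λ p q c → (p :+ q) :+ c := p :+ (c :+ q)) refl
           (parity (link h) p) (parity (link h) q) (parity (inner h) c)))))
      where open xor-∧-Solver
    stackΦ-chain p c q (s ∷ ss) ρ e = *-cong (Φ-cong c first) (stackΦ-chain c s q ss (ρ ∘ suc) rest)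
      where
      open xor-∧-Solver
      first : ∀ h → ρ 0 h ≡ parity (link h) p xor (parity (inner h) c xor parity (link h) s)
      first h = ≡.trans (e 0 h) (cong₂ _xor_ (xor-identityʳ (parity (link h) p)) (cong₂ _xor_
        (parity-cong (λ h′ → xor-identityʳ (inner h h′)) c)
        (≡.trans (cong (parity (link h) s xor_) (stackParity-false ss)) (xor-identityʳ (parity (link h) s)))))
      -- From layer i + 1 the old boundary p is out of reach, and c is reached exactly when i = 0,
      -- so c acts as the new left boundary.
      rest : ∀ i h → ρ (suc i) h ≡ (((0 ≡ᵇ i) ∧ parity (link h) c) xor ((i ≡ᵇ _) ∧ parity (link h) q))
                                   xor stackParity (chainAdj i h) (s ∷ ss)
      rest i h = ≡.trans (e (suc i) h)
        (≡.trans (cong (λ z → ((i ≡ᵇ _) ∧ parity (link h) q) xor (z xor stackParity (chainAdj i h) (s ∷ ss)))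
                       (parity-∧ (0 ≡ᵇ i) (link h) c))
          (solve 3 (λ q c r → q :+ (c :+ r) := (c :+ q) :+ r) refl
             ((i ≡ᵇ _) ∧ parity (link h) q) ((0 ≡ᵇ i) ∧ parity (link h) c) _))

    module _ {P : Carrier → Set} (sub : IsSubring R P) (t∈ : P t) where
      open IsSubring sub
      open PowerSeries R using (series; polySubring; X; X-poly; const; const-⊛; const-poly; X-⊛-suc; ∑-coeff)
      open Fractions series (polySubring sub) X (X-poly sub)

      -- The unknowns are indexed by pairs of states of consecutive layers. The given p may be no
      -- state at all, for instance a coloring of the whole base; one step of the recurrence leads
      -- from (p , c) to pairs of states, so `row` expresses its series through the unknowns.
      chain-rational : (fin : Coloring H → Coloring H → Carrier) → (∀ p c → P (fin p c)) →
        ∀ p {c} → c ∈ states → Rat (λ k → ∑ (sequences k) (λ ss → run p c ss fin))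
      chain-rational fin fin∈ p {c} c∈ =
        affine⇒rat y pairs (λ {j} → solve-system y pairs 1-denominator affine {j}) (row p c∈)
        where
        module S = CommutativeRing series
        Z : Coloring H → Coloring H → S.Carrier
        Z p c k = ∑ (sequences k) (λ ss → run p c ss fin)
        y : Coloring H × Coloring H → S.Carrier
        y (p , c) = Z p c
        pairs : List (Coloring H × Coloring H)
        pairs = cartesianProduct states states

        terms : Coloring H → Coloring H → S.Carrier
        terms p c = Sums.∑ series states (λ s → const (local p c s) S.* (X S.* Z c s))

        Z-step : ∀ p c k → Z p c (suc k) ≈ ∑ states (λ s → local p c s * Z c s k)
        Z-step p c k = ≈-trans (∑-sequences-suc k _)
          (∑-cong states (λ s → ≈-sym (∑-*ˡ (sequences k) (local p c s) _)))

        -- The constant term is the chain without further layers, and each further layer costs one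
        -- factor x.
        Z-equation : ∀ p c → const (fin p c) S.+ terms p c S.≈ Z p c
        Z-equation p c zero = +-congˡ (≈-trans (∑-coeff states _ 0)
          (≈-trans (∑-cong states (λ s → ≈-trans (*-congˡ (zeroˡ _)) (zeroʳ _))) (∑-0 states)))
        Z-equation p c (suc k) = ≈-trans (+-identityˡ _) (≈-trans (∑-coeff states _ (suc k))
          (≈-trans (∑-cong states (λ s → ≈-trans (const-⊛ (local p c s) (X S.* Z c s) (suc k))
                                           (*-congˡ (X-⊛-suc (Z c s) k))))
                   (≈-sym (Z-step p c k))))

        row : ∀ p {c} → c ∈ states → Affine y pairs (Z p c)
        row p {c} c∈ = affine-resp y pairs (Z-equation p c)
          (affine-+ y pairs (affine-const y pairs (const-poly sub (fin∈ p c)))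
            (affine-∑ y pairs states (λ {s} s∈ →
              affine-* y pairs (const-poly sub (Φ∈ sub t∈ c _))
                (affine-var y pairs (∈-cartesianProduct⁺ c∈ s∈)))))

        affine : ∀ {j} → j ∈ pairs → Affine y pairs (S.1# S.* y j)
        affine {p , c} j∈ = affine-resp y pairs (S.sym (S.*-identityˡ (Z p c)))
          (row p (proj₂ (∈-cartesianProduct⁻ states states j∈)))

-- Gluing a path or a cycle of layers to a graph

-- What follows the last layer: the base again if the layers form a cycle, nothing if they form a
-- path.
closing : {N : Set} → Bool → Coloring N → Coloring N
closing true  p = p
closing false p = []

parity-closing : {N : Set} (b : Bool) (r : N → Bool) (p : Coloring N) →
                 parity (λ h → b ∧ r h) p ≡ parity r (closing b p)
parity-closing true  r p = refl
parity-closing false r p = parity-false p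

module Gluing (R : CommutativeRing 0ℓ 0ℓ) (t : CommutativeRing.Carrier R)
              {N : Set} (vs hs : List N) (a inner link : N → N → Bool) (cyclic : Bool) where
  open CommutativeRing R hiding (zero) renaming (refl to ≈-refl; sym to ≈-sym; trans to ≈-trans)
  open Sums R
  open Weights R t
  open Chains R t
  open Chain hs inner link
  open import Relation.Binary.Reasoning.Setoid setoid

  -- The layers are numbered 0, …, k + 1.
  gluedAdj : ℕ → N × ℕ → N × ℕ → Bool
  gluedAdj k (u , zero)  (v , zero)  = a u v
  gluedAdj k (u , zero)  (v , suc i) = ((0 ≡ᵇ i) ∧ link u v) xor ((i ≡ᵇ k) ∧ (cyclic ∧ link u v))
  gluedAdj k (u , suc i) (v , zero)  = ((0 ≡ᵇ i) ∧ link u v) xor ((i ≡ᵇ k) ∧ (cyclic ∧ link u v))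
  gluedAdj k (u , suc i) (v , suc j) = chainAdj i u j v

  base : N → N × ℕ
  base v = v , 0

  layer : ℕ → N → N × ℕ
  layer i v = v , suc i

  gluedVerts : ℕ → List (N × ℕ)
  gluedVerts k = map base vs ++ layers layer hs (suc k)

  baseΦ : Coloring N → Coloring N → Coloring N → Carrier
  baseΦ p s c = Φ p (λ v → parity (a v) p xor (parity (link v) s xor parity (λ h → cyclic ∧ link v h) c))

  -- The base sees the first layer s, which is fixed before the run starts, and in the cyclic case
  -- also the last layer; hence its weight joins the boundary term.
  final : Coloring N → Coloring N → Coloring N → Coloring N → Carrier
  final p s p′ c′ = baseΦ p s c′ * local p′ c′ (closing cyclic p)

  glued-weight : ∀ k p s (ss : Vec (Coloring N) k) →
    (let all = relabel base p ++ stack layer (s ∷ ss)) →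
    Φ all (λ v → parity (gluedAdj k v) all) ≈ run p s ss (final p s)
  glued-weight k p s ss = begin
    Φ (relabel base p ++ stack layer (s ∷ ss)) ρ
      ≈⟨ Φ-++ (relabel base p) _ ρ ⟩
    Φ (relabel base p) ρ * Φ (stack layer (s ∷ ss)) ρ
      ≈⟨ *-cong (≈-trans (Φ-relabel base p ρ) (Φ-cong p base-parity))
                (≈-trans (Φ-stack layer (s ∷ ss) ρ)
                  (stackΦ-chain p s (closing cyclic p) ss (λ i h → ρ (h , suc i)) layer-parity)) ⟩
    baseΦ p s (end s ss) * run p s ss (λ p′ c′ → local p′ c′ (closing cyclic p))
      ≈⟨ run-* p s ss _ (baseΦ p s) ⟩
    run p s ss (final p s) ∎
    where
    ρ : N × ℕ → Bool
    ρ v = parity (gluedAdj k v) (relabel base p ++ stack layer (s ∷ ss))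

    split : ∀ v → ρ v ≡ parity (λ u → gluedAdj k v (base u)) p
                        xor stackParity (λ i u → gluedAdj k v (layer i u)) (s ∷ ss)
    split v = ≡.trans (parity-++ (gluedAdj k v) (relabel base p) _)
      (cong₂ _xor_ (parity-relabel (gluedAdj k v) base p) (parity-stack (gluedAdj k v) layer (s ∷ ss)))

    base-parity : ∀ v → ρ (base v) ≡ parity (a v) p xor
      (parity (link v) s xor parity (λ h → cyclic ∧ link v h) (end s ss))
    base-parity v = ≡.trans (split (base v)) (cong (parity (a v) p xor_)
      (≡.trans (stackParity-xor (λ i h → (0 ≡ᵇ i) ∧ link v h) (λ i h → (i ≡ᵇ k) ∧ (cyclic ∧ link v h)) (s ∷ ss))
        (cong₂ _xor_ (stackParity-first (link v) s ss) (stackParity-last (λ h → cyclic ∧ link v h) s ss))))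

    layer-parity : ∀ i h → ρ (h , suc i) ≡
      (((0 ≡ᵇ i) ∧ parity (link h) p) xor ((i ≡ᵇ k) ∧ parity (link h) (closing cyclic p)))
      xor stackParity (chainAdj i h) (s ∷ ss)
    layer-parity i h = ≡.trans (split (h , suc i)) (cong (_xor stackParity (chainAdj i h) (s ∷ ss))
      (≡.trans (parity-xor (λ u → (0 ≡ᵇ i) ∧ link h u) _ p)
        (cong₂ _xor_ (parity-∧ (0 ≡ᵇ i) (link h) p)
          (≡.trans (parity-∧ (i ≡ᵇ k) (λ u → cyclic ∧ link h u) p)
                   (cong ((i ≡ᵇ k) ∧_) (parity-closing cyclic (link h) p))))))

  W-glued : ∀ k → W (gluedAdj k) (gluedVerts k) ≈
            ∑ (colorings vs) (λ p → ∑ states (λ s → ∑ (sequences k) (λ ss → run p s ss (final p s))))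
  W-glued k = begin
    W (gluedAdj k) (gluedVerts k)
      ≈⟨ ∑-colorings-++ (map base vs) _ _ ⟩
    _ ≈⟨ ∑-colorings-map base vs _ ⟩
    _ ≈⟨ ∑-cong (colorings vs) (λ p → ≈-trans (∑-colorings-layers layer (suc k) _)
           (≈-trans (∑-sequences-suc k _)
             (∑-cong states (λ s → ∑-cong (sequences k) (glued-weight k p s))))) ⟩
    _ ∎

  module _ {P : Carrier → Set} (sub : IsSubring R P) (t∈ : P t) where
    open IsSubring sub
    open PowerSeries R using (series; polySubring; X; X-poly; ∑-coeff)
    open Fractions series (polySubring sub) X (X-poly sub)

    glued-rational : Rat (λ k → W (gluedAdj k) (gluedVerts k))
    glued-rational = rat-resp (λ k → ≈-sym (≈-trans (W-glued k) (≈-sym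
        (≈-trans (∑-coeff (colorings vs) _ k) (∑-cong (colorings vs) (λ p → ∑-coeff states _ k))))))
      (rat-∑ (colorings vs) (λ {p} _ → rat-∑ states (λ {s} s∈ →
        chain-rational sub t∈ (final p s)
          (λ p′ c′ → *∈ (Φ∈ sub t∈ p _) (Φ∈ sub t∈ c′ _)) p s∈)))

-- Subdivision of edges

⨁ : (Fin r → Bool) → Bool
⨁ {zero}  f = false
⨁ {suc r} f = f zero xor ⨁ (f ∘ suc)

⨁-cong : {f g : Fin r → Bool} → (∀ k → f k ≡ g k) → ⨁ f ≡ ⨁ g
⨁-cong {zero}  e = refl
⨁-cong {suc r} e = cong₂ _xor_ (e zero) (⨁-cong (e ∘ suc))

⨁-false : ∀ r → ⨁ {r} (λ _ → false) ≡ false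
⨁-false zero    = refl
⨁-false (suc r) = ⨁-false r

⨁-xor : (f g : Fin r → Bool) → ⨁ (λ k → f k xor g k) ≡ ⨁ f xor ⨁ g
⨁-xor {zero}  f g = refl
⨁-xor {suc r} f g = ≡.trans (cong ((f zero xor g zero) xor_) (⨁-xor (f ∘ suc) (g ∘ suc)))
  (solve 4 (λ a b c d → (a :+ b) :+ (c :+ d) := (a :+ c) :+ (b :+ d)) refl (f zero) (g zero) _ _)
  where open xor-∧-Solver

⨁-δ : (k : Fin r) (f : Fin r → Bool) → ⨁ (λ l → (k == l) ∧ f l) ≡ f k
⨁-δ {suc r} zero    f = ≡.trans (cong (f zero xor_) (⨁-false r)) (xor-identityʳ _)
⨁-δ {suc r} (suc k) f = ⨁-δ k (f ∘ suc)

parity-⨁ : (f : Fin r → A → Bool) (c : Coloring A) →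
           parity (λ v → ⨁ (λ k → f k v)) c ≡ ⨁ (λ k → parity (f k) c)
parity-⨁ {zero}  f c = parity-false c
parity-⨁ {suc r} f c = ≡.trans (parity-xor (f zero) _ c) (cong (parity (f zero) c xor_) (parity-⨁ (f ∘ suc) c))

-- At most one k satisfies `Q`, and then a is true, so deleting the edge amounts to adding it once
-- more modulo 2. The form with `tabulate κ` lets the induction pass to `κ ∘ suc`.
removal-parity : {K : Set} (κ : Fin r → K) (Q : K → Bool) (a : Bool) →
  (∀ k l → k ≢ l → Q (κ k) ∧ Q (κ l) ≡ false) → (∀ k → Q (κ k) ≡ true → a ≡ true) →
  a ∧ (countB Q (tabulate κ) ≡ᵇ 0) ≡ a xor ⨁ (Q ∘ κ)
removal-parity {zero}  κ Q a excl imp = ≡.trans (∧-identityʳ a) (≡.sym (xor-identityʳ a))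
removal-parity {suc r} κ Q a excl imp with Q (κ zero) in eq
... | false = removal-parity (κ ∘ suc) Q a (λ k l k≢l → excl (suc k) (suc l) (k≢l ∘ suc-injective)) (imp ∘ suc)
... | true  = ≡.trans (∧-zeroʳ a) (≡.sym (cong₂ (λ x y → x xor not y) (imp zero eq)
    (≡.trans (⨁-cong (λ k → ≡.trans (cong (_∧ Q (κ (suc k))) (≡.sym eq)) (excl zero (suc k) λ ())))
             (⨁-false r))))

∨-xor : ∀ α x β y → x ∧ y ≡ false → (α ∧ x) ∨ (β ∧ y) ≡ (α ∧ x) xor (β ∧ y)
∨-xor true  true  true  true  ()
∨-xor true  true  true  false _ = refl
∨-xor true  true  false y     _ = refl
∨-xor true  false β     y     _ = refl
∨-xor false x     β     y     _ = refl

xor-∧-collect : ∀ x y q p f l →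
  ((x ∧ q) xor (y ∧ p)) xor ((x ∧ f) xor (y ∧ l)) ≡ (x ∧ (f xor q)) xor (y ∧ (l xor p))
xor-∧-collect = solve 6 (λ x y q p f l →
  (x :* q :+ y :* p) :+ (x :* f :+ y :* l) := x :* (f :+ q) :+ y :* (l :+ p)) refl
  where open xor-∧-Solver

≡ᵇ-sym : ∀ m n → (m ≡ᵇ n) ≡ (n ≡ᵇ m)
≡ᵇ-sym zero    zero    = refl
≡ᵇ-sym zero    (suc n) = refl
≡ᵇ-sym (suc m) zero    = refl
≡ᵇ-sym (suc m) (suc n) = ≡ᵇ-sym m n

==-sym : ∀ {n} (i j : Fin n) → (i == j) ≡ (j == i)
==-sym i j = ≡ᵇ-sym (toℕ i) (toℕ j)

-- A path is a chain of one-vertex layers, hence colorings of the unit type.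
Paths : {r : ℕ} → (Fin r → ℕ) → Set
Paths c = ∀ k → Vec (Coloring ⊤) (c k)

consPaths : {c : Fin (suc r) → ℕ} → Vec (Coloring ⊤) (c zero) → Paths (c ∘ suc) → Paths c
consPaths s T zero    = s
consPaths s T (suc k) = T k

blockVerts : (Fin r → ℕ → A) → (Fin r → ℕ) → List A
blockVerts {zero}  ι c = []
blockVerts {suc r} ι c = layers (λ i _ → ι zero i) (tt ∷ []) (c zero) ++ blockVerts (ι ∘ suc) (c ∘ suc)

blocks : {c : Fin r → ℕ} → (Fin r → ℕ → A) → Paths c → Coloring A
blocks {zero}  ι T = []
blocks {suc r} ι T = stack (λ i _ → ι zero i) (T zero) ++ blocks (ι ∘ suc) (T ∘ suc)

parity-blocks : {c : Fin r → ℕ} (q : A → Bool) (ι : Fin r → ℕ → A) (T : Paths c) →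
  parity q (blocks ι T) ≡ ⨁ (λ k → stackParity (λ i _ → q (ι k i)) (T k))
parity-blocks {zero}  q ι T = refl
parity-blocks {suc r} q ι T = ≡.trans (parity-++ q (stack _ (T zero)) _)
  (cong₂ _xor_ (parity-stack q _ (T zero)) (parity-blocks q (ι ∘ suc) (T ∘ suc)))

blockVerts-tabulate : {K : Set} (κ : Fin r → K) (ι : K → ℕ → A) (c : K → ℕ) →
  concatMap (λ k → map (ι k) (upTo (c k))) (tabulate κ) ≡ blockVerts (ι ∘ κ) (c ∘ κ)
blockVerts-tabulate {zero}  κ ι c = refl
blockVerts-tabulate {suc r} κ ι c = cong₂ _++_ (layers-upTo (ι (κ zero)) (c (κ zero)))
  (blockVerts-tabulate (κ ∘ suc) ι c)
  where
  layers-applyUpTo : (f : ℕ → _) (m : ℕ) → applyUpTo f m ≡ layers (λ i _ → f i) (tt ∷ []) m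
  layers-applyUpTo f zero    = refl
  layers-applyUpTo f (suc m) = cong (f 0 ∷_) (layers-applyUpTo (f ∘ suc) m)
  layers-upTo : (f : ℕ → _) (m : ℕ) → map f (upTo m) ≡ layers (λ i _ → f i) (tt ∷ []) m
  layers-upTo f m = ≡.trans (map-upTo f m) (layers-applyUpTo f m)

isBlack : Coloring ⊤ → Bool
isBlack = parity (λ _ → true)

-- The change in the parities of the end vertices, of colors p and q, when their edge is replaced by a path.
seen : Bool × Bool → Vec (Coloring ⊤) k → Bool × Bool
seen (p , q) []       = false , false
seen (p , q) (s ∷ ss) = isBlack s xor q , isBlack (end s ss) xor p

module Subdivision (R : CommutativeRing 0ℓ 0ℓ) (t : CommutativeRing.Carrier R) where
  open CommutativeRing R hiding (zero) renaming (refl to ≈-refl; sym to ≈-sym; trans to ≈-trans)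
  open SemiringSolver commutativeSemiring using (solve; _:=_; _:+_; _:*_; con)
  open Sums R
  open Weights R t
  open Chains R t
  open Chain (tt ∷ []) (λ _ _ → false) (λ _ _ → true)
  open import Relation.Binary.Reasoning.Setoid setoid

  ∏ : (Fin r → Carrier) → Carrier
  ∏ {zero}  f = 1#
  ∏ {suc r} f = f zero * ∏ (f ∘ suc)

  ∏-cong : {f g : Fin r → Carrier} → (∀ k → f k ≈ g k) → ∏ f ≈ ∏ g
  ∏-cong {zero}  e = ≈-refl
  ∏-cong {suc r} e = *-cong (e zero) (∏-cong (e ∘ suc))

  ∑ᴾ : (c : Fin r → ℕ) → (Paths c → Carrier) → Carrier
  ∑ᴾ {zero}  c f = f (λ ())
  ∑ᴾ {suc r} c f = ∑ (sequences (c zero)) (λ s → ∑ᴾ (c ∘ suc) (λ T → f (consPaths s T)))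

  ∑ᴾ-cong : (c : Fin r → ℕ) {f g : Paths c → Carrier} → (∀ T → f T ≈ g T) → ∑ᴾ c f ≈ ∑ᴾ c g
  ∑ᴾ-cong {zero}  c e = e _
  ∑ᴾ-cong {suc r} c e = ∑-cong (sequences (c zero)) (λ s → ∑ᴾ-cong (c ∘ suc) (λ T → e (consPaths s T)))

  ∑ᴾ-*ˡ : (c : Fin r → ℕ) (a : Carrier) (f : Paths c → Carrier) → a * ∑ᴾ c f ≈ ∑ᴾ c (λ T → a * f T)
  ∑ᴾ-*ˡ {zero}  c a f = ≈-refl
  ∑ᴾ-*ˡ {suc r} c a f = ≈-trans (∑-*ˡ (sequences (c zero)) a _)
    (∑-cong (sequences (c zero)) (λ s → ∑ᴾ-*ˡ (c ∘ suc) a _))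

  ∑-colorings-blocks : (ι : Fin r → ℕ → A) (c : Fin r → ℕ) (f : Coloring A → Carrier) →
    ∑ (colorings (blockVerts ι c)) f ≈ ∑ᴾ c (f ∘ blocks ι)
  ∑-colorings-blocks {zero}  ι c f = +-identityʳ _
  ∑-colorings-blocks {suc r} ι c f = begin
    _ ≈⟨ ∑-colorings-++ (layers _ (tt ∷ []) (c zero)) _ f ⟩
    _ ≈⟨ ∑-colorings-layers _ (c zero) _ ⟩
    _ ≈⟨ ∑-cong (sequences (c zero)) (λ s → ∑-colorings-blocks (ι ∘ suc) (c ∘ suc) _) ⟩
    _ ∎

  Φ-blocks : {c : Fin r → ℕ} (ι : Fin r → ℕ → A) (T : Paths c) (ρ : A → Bool) →
    Φ (blocks ι T) ρ ≈ ∏ (λ k → stackΦ (T k) (λ i _ → ρ (ι k i)))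
  Φ-blocks {zero}  ι T ρ = ≈-refl
  Φ-blocks {suc r} ι T ρ = ≈-trans (Φ-++ (stack _ (T zero)) _ ρ)
    (*-cong (Φ-stack _ (T zero) ρ) (Φ-blocks (ι ∘ suc) (T ∘ suc) ρ))

  dot : Bool → Coloring ⊤
  dot p = (tt , p) ∷ []

  isBlack-dot : ∀ p → isBlack (dot p) ≡ p
  isBlack-dot true  = refl
  isBlack-dot false = refl

  pathΦ : Bool × Bool → Vec (Coloring ⊤) k → Carrier
  pathΦ (p , q) []       = 1#
  pathΦ (p , q) (s ∷ ss) = run (dot p) s ss (λ p′ s′ → local p′ s′ (dot q))

  -- The two ends of the subdivided edge serve as the boundaries of the chain, taken as one-vertex
  -- layers `dot p` and `dot q`.
  stackΦ-path : ∀ p q (ss : Vec (Coloring ⊤) k) (ρ : ℕ → Bool) →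
    (∀ i → ρ i ≡ (((i ≡ᵇ 0) ∧ p) xor ((suc i ≡ᵇ k) ∧ q))
                 xor stackParity (λ j _ → (suc i ≡ᵇ j) ∨ (suc j ≡ᵇ i)) ss) →
    stackΦ ss (λ i _ → ρ i) ≈ pathΦ (p , q) ss
  stackΦ-path p q []       ρ e = ≈-refl
  stackΦ-path p q (s ∷ ss) ρ e = stackΦ-chain (dot p) s (dot q) ss _ (λ i _ → ≡.trans (e i)
    (cong₂ _xor_
      (cong₂ _xor_ (cong₂ _∧_ (≡ᵇ-sym i 0) (≡.sym (isBlack-dot p))) (cong ((i ≡ᵇ _) ∧_) (≡.sym (isBlack-dot q))))
      (stackParity-cong (λ j _ → ≡.sym
        (cong₂ _xor_ (∧-zeroʳ (i ≡ᵇ j)) (∧-identityʳ ((suc i ≡ᵇ j) ∨ (suc j ≡ᵇ i))))) (s ∷ ss))))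

  indicator : Bool × Bool → Bool × Bool → Carrier
  indicator (x , y) (x′ , y′) = if x xor x′ then 0# else if y xor y′ then 0# else 1#

  abstract
    corners : List (Bool × Bool)
    corners = (true , true) ∷ (true , false) ∷ (false , true) ∷ (false , false) ∷ []

    -- Expanding a function of the bits d in delta functions separates it from the path that
    -- produces these bits; this turns `total` into a sum of products.
    ∑-indicator : ∀ d (g : Bool × Bool → Carrier) → ∑ corners (λ e → indicator e d * g e) ≈ g d
    ∑-indicator (true  , true)  g = solve 4 (λ a b c d →
      con 1 :* a :+ (con 0 :* b :+ (con 0 :* c :+ (con 0 :* d :+ con 0))) := a) ≈-refl _ _ _ _
    ∑-indicator (true  , false) g = solve 4 (λ a b c d →
      con 0 :* a :+ (con 1 :* b :+ (con 0 :* c :+ (con 0 :* d :+ con 0))) := b) ≈-refl _ _ _ _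
    ∑-indicator (false , true)  g = solve 4 (λ a b c d →
      con 0 :* a :+ (con 0 :* b :+ (con 1 :* c :+ (con 0 :* d :+ con 0))) := c) ≈-refl _ _ _ _
    ∑-indicator (false , false) g = solve 4 (λ a b c d →
      con 0 :* a :+ (con 0 :* b :+ (con 0 :* c :+ (con 1 :* d :+ con 0))) := d) ≈-refl _ _ _ _

  -- Here b is the weight of the old vertices, which depends on the colorings of the paths only
  -- through two bits per path.
  total : (ends : Fin r → Bool × Bool) (b : (Fin r → Bool × Bool) → Carrier) (c : Fin r → ℕ) → Carrier
  total ends b c = ∑ᴾ c (λ T → b (λ k → seen (ends k) (T k)) * ∏ (λ k → pathΦ (ends k) (T k)))

  Extensional : ((Fin r → Bool × Bool) → Carrier) → Set
  Extensional b = ∀ {d d′} → (∀ k → d k ≡ d′ k) → b d ≈ b d′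

  ◂-cong : ∀ e {d d′ : Fin r → Bool × Bool} → (∀ k → d k ≡ d′ k) → ∀ k → (e ◂ d) k ≡ (e ◂ d′) k
  ◂-cong e p zero    = refl
  ◂-cong e p (suc k) = p k

  kernel : Bool × Bool → Bool × Bool → ℕ → Carrier
  kernel pq e n = ∑ (sequences n) (λ s → indicator e (seen pq s) * pathΦ pq s)

  -- Once the bits e of the first path are fixed, b no longer depends on the coloring of that path,
  -- and the sum over it splits off as `kernel`.
  total-suc : (ends : Fin (suc r) → Bool × Bool) (b : (Fin (suc r) → Bool × Bool) → Carrier) →
    Extensional b → (c : Fin (suc r) → ℕ) →
    total ends b c ≈ ∑ corners (λ e → kernel (ends zero) e (c zero) * total (ends ∘ suc) (b ∘ (e ◂_)) (c ∘ suc))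
  total-suc ends b ext c = begin
    total ends b c
      ≈⟨ ∑-cong (sequences (c zero)) (λ s → begin
           _ ≈⟨ ∑ᴾ-cong (c ∘ suc) (λ T → ≈-trans (*-congʳ (ext (λ { zero → refl ; (suc k) → refl })))
                 (solve 3 (λ x y z → x :* (y :* z) := y :* (x :* z)) ≈-refl _ _ _)) ⟩
           _ ≈⟨ ∑ᴾ-*ˡ (c ∘ suc) (pathΦ (ends zero) s) _ ⟨
           pathΦ (ends zero) s * rest (seen (ends zero) s)
             ≈⟨ *-congˡ (∑-indicator (seen (ends zero) s) rest) ⟨
           pathΦ (ends zero) s * ∑ corners (λ e → indicator e (seen (ends zero) s) * rest e)
             ≈⟨ ∑-*ˡ corners (pathΦ (ends zero) s) _ ⟩
           _ ≈⟨ ∑-cong corners (λ e → solve 3 (λ x y z → x :* (y :* z) := y :* x :* z) ≈-refl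
                  (pathΦ (ends zero) s) (indicator e (seen (ends zero) s)) (rest e)) ⟩
           ∑ corners (λ e → term e s * rest e) ∎) ⟩
    ∑ (sequences (c zero)) (λ s → ∑ corners (λ e → term e s * rest e))
      ≈⟨ ∑-swap (sequences (c zero)) corners (λ s e → term e s * rest e) ⟩
    _ ≈⟨ ∑-cong corners (λ e → ∑-*ʳ (sequences (c zero)) (rest e) (term e)) ⟨
    ∑ corners (λ e → kernel (ends zero) e (c zero) * rest e) ∎
    where
    term : Bool × Bool → Vec (Coloring ⊤) (c zero) → Carrier
    term e s = indicator e (seen (ends zero) s) * pathΦ (ends zero) s
    rest : Bool × Bool → Carrier
    rest e = total (ends ∘ suc) (b ∘ (e ◂_)) (c ∘ suc)

  module _ {P : Carrier → Set} (sub : IsSubring R P) (t∈ : P t) where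
    open IsSubring sub
    open PowerSeries R
    open Fractions series (polySubring sub) X (X-poly sub)

    indicator∈ : ∀ e d → P (indicator e d)
    indicator∈ (x , y) (x′ , y′) with x xor x′ | y xor y′
    ... | true  | _     = 0∈
    ... | false | true  = 0∈
    ... | false | false = 1∈

    -- Without new vertices the edge stays in place and `seen` is zero, so this case is kept apart
    -- as the constant term. Otherwise the first color s is fixed; the indicator then depends on the
    -- last vertex only and moves into the boundary term of a chain.
    kernel-rational : ∀ pq e → Rat (kernel pq e)
    kernel-rational (p , q) e = rat-resp (λ n → ≈-sym (head-tail (kernel (p , q) e) n))
      (rat-+ (rat-∈ (const-poly sub (+∈ (*∈ (indicator∈ e _) 1∈) 0∈)))
        (rat-* (rat-∈ (X-poly sub)) (rat-resp tail
          (rat-∑ states (λ {s} s∈ → chain-rational sub t∈ (fin s)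
            (λ _ s′ → *∈ (indicator∈ e _) (Φ∈ sub t∈ s′ _)) (dot p) s∈)))))
      where
      fin : Coloring ⊤ → Coloring ⊤ → Coloring ⊤ → Carrier
      fin s p′ s′ = indicator e (isBlack s xor q , isBlack s′ xor p) * local p′ s′ (dot q)
      tail : ∀ n → Sums.∑ series states (λ s k → ∑ (sequences k) (λ ss → run (dot p) s ss (fin s))) n
                   ≈ kernel (p , q) e (suc n)
      tail n = begin
        _ ≈⟨ ∑-coeff states (λ s k → ∑ (sequences k) (λ ss → run (dot p) s ss (fin s))) n ⟩
        _ ≈⟨ ∑-cong states (λ s → ∑-cong (sequences n) (λ ss →
               ≈-sym (run-* (dot p) s ss (λ p′ s′ → local p′ s′ (dot q))
                 (λ s′ → indicator e (isBlack s xor q , isBlack s′ xor p))))) ⟩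
        _ ≈⟨ ∑-sequences-suc n (λ s → indicator e (seen (p , q) s) * pathΦ (p , q) s) ⟨
        _ ∎

    -- Splitting a composition into its first part i and the rest makes the sum a Cauchy product of
    -- a kernel with the series for the remaining edges, for each choice of the bits e; hence
    -- induction on r.
    total-rational : (ends : Fin r → Bool × Bool) (b : (Fin r → Bool × Bool) → Carrier) →
      Extensional b → (∀ d → P (b d)) → Rat (λ s → ∑ (compositions r s) (total ends b))
    total-rational {zero} ends b ext b∈ =
      rat-resp {const (b (λ ()))}
        -- `compositions 0 s` has one entry for s = 0 and none otherwise, so the series is constant.
        (λ { zero → ≈-sym (≈-trans (+-identityʳ _) (≈-trans (*-identityʳ _) (ext (λ ())))) ; (suc _) → ≈-refl })
        (rat-∈ (const-poly sub (b∈ (λ ()))))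
    total-rational {suc r} ends b ext b∈ = rat-resp (λ s → ≈-sym (step s))
      (rat-∑ corners (λ {e} _ → rat-* (kernel-rational (ends zero) e)
        (total-rational (ends ∘ suc) (b ∘ (e ◂_)) (λ p → ext (◂-cong e p)) (λ d → b∈ (e ◂ d)))))
      where
      rest : Bool × Bool → ℕ → Carrier
      rest e s = ∑ (compositions r s) (total (ends ∘ suc) (b ∘ (e ◂_)))
      step : ∀ s → ∑ (compositions (suc r) s) (total ends b) ≈
                   Sums.∑ series corners (λ e → kernel (ends zero) e ⊛ rest e) s
      step s = begin
        ∑ (compositions (suc r) s) (total ends b)
          ≈⟨ ∑-concatMap (λ i → map (i ◂_) (compositions r (s ℕ.∸ i))) (upTo (suc s)) (total ends b) ⟩
        _ ≈⟨ ∑-cong (upTo (suc s)) (λ i → begin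
               _ ≈⟨ ∑-map (i ◂_) (compositions r (s ℕ.∸ i)) (total ends b) ⟩
               _ ≈⟨ ∑-cong (compositions r (s ℕ.∸ i)) (λ c → total-suc ends b ext (i ◂ c)) ⟩
               _ ≈⟨ ∑-swap (compositions r (s ℕ.∸ i)) corners
                      (λ c e → kernel (ends zero) e i * total (ends ∘ suc) (b ∘ (e ◂_)) c) ⟩
               _ ≈⟨ ∑-cong corners (λ e → ∑-*ˡ (compositions r (s ℕ.∸ i)) (kernel (ends zero) e i) _) ⟨
               ∑ corners (λ e → kernel (ends zero) e i * rest e (s ℕ.∸ i)) ∎) ⟩
        ∑ (upTo (suc s)) (λ i → ∑ corners (λ e → kernel (ends zero) e i * rest e (s ℕ.∸ i)))
          ≈⟨ ∑-swap (upTo (suc s)) corners (λ i e → kernel (ends zero) e i * rest e (s ℕ.∸ i)) ⟩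
        _ ≈⟨ ∑-cong corners (λ e → ⊛-upTo (kernel (ends zero) e) (rest e) s) ⟨
        _ ≈⟨ ∑-coeff corners (λ e → kernel (ends zero) e ⊛ rest e) s ⟨
        Sums.∑ series corners (λ e → kernel (ends zero) e ⊛ rest e) s ∎

    total₁-rational : (ends : Fin 1 → Bool × Bool) (b : (Fin 1 → Bool × Bool) → Carrier) →
      Extensional b → (∀ d → P (b d)) → Rat (λ m → total ends b (λ _ → m))
    total₁-rational ends b ext b∈ = rat-resp (λ m → begin
        _ ≈⟨ ∑-coeff corners (λ e → const (b (e ◂ ⟨⟩)) ⊛ kernel (ends zero) e) m ⟩
        _ ≈⟨ ∑-cong corners (λ e → ≈-trans (const-⊛ (b (e ◂ ⟨⟩)) (kernel (ends zero) e) m)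
               (≈-trans (*-comm _ _) (*-congˡ (≈-trans (ext (◂-cong e (λ ()))) (≈-sym (*-identityʳ _)))))) ⟩
        _ ≈⟨ total-suc ends b ext (λ _ → m) ⟨
        total ends b (λ _ → m) ∎)
      (rat-∑ corners (λ {e} _ → rat-* (rat-∈ (const-poly sub (b∈ (e ◂ ⟨⟩)))) (kernel-rational (ends zero) e)))

  module Subdivided {n r : ℕ} (a : FinAdj n) (F : Fin r → Fin n × Fin n)
           (distinct-ends : ∀ k u → (u == proj₁ (F k)) ∧ (u == proj₂ (F k)) ≡ false)
           (distinct-edges : ∀ u v k l → k ≢ l → sameEdge (F k) u v ∧ sameEdge (F l) u v ≡ false)
           (are-edges : ∀ u v k → sameEdge (F k) u v ≡ true → a u v ≡ true) where

    -- Reading a color as a parity keeps it additive in p, so it combines directly with the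
    -- neighbour counts.
    color : Coloring (Fin n) → Fin n → Bool
    color p x = parity (_== x) p

    endColors : Coloring (Fin n) → Fin r → Bool × Bool
    endColors p k = color p (proj₁ (F k)) , color p (proj₂ (F k))

    correction : Fin n → (Fin r → Bool × Bool) → Bool
    correction v d = ⨁ (λ k → ((v == proj₁ (F k)) ∧ proj₁ (d k)) xor ((v == proj₂ (F k)) ∧ proj₂ (d k)))

    baseΦ : Coloring (Fin n) → (Fin r → Bool × Bool) → Carrier
    baseΦ p d = Φ p (λ v → parity (a v) p xor correction v d)

    baseΦ-cong : ∀ p → Extensional (baseΦ p)
    baseΦ-cong p e = Φ-cong p (λ v → cong (parity (a v) p xor_) (⨁-cong (λ k →
      cong (λ z → ((v == proj₁ (F k)) ∧ proj₁ z) xor ((v == proj₂ (F k)) ∧ proj₂ z)) (e k))))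

    edge-parity : ∀ p v k → parity (sameEdge (F k) v) p ≡
      ((v == proj₁ (F k)) ∧ color p (proj₂ (F k))) xor ((v == proj₂ (F k)) ∧ color p (proj₁ (F k)))
    edge-parity p v k = ≡.trans (parity-cong (λ w → ≡.trans (cong₂ _∨_
          (cong₂ _∧_ (==-sym (proj₁ (F k)) v) (==-sym (proj₂ (F k)) w))
          (≡.trans (cong₂ _∧_ (==-sym (proj₁ (F k)) w) (==-sym (proj₂ (F k)) v)) (∧-comm (w == proj₁ (F k)) _)))
        (disjoint (v == proj₁ (F k)) (v == proj₂ (F k)) _ _ (distinct-ends k v))) p)
      (≡.trans (parity-xor _ _ p)
        (cong₂ _xor_ (parity-∧ (v == proj₁ (F k)) _ p) (parity-∧ (v == proj₂ (F k)) _ p)))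
      where
      disjoint : ∀ x y α β → x ∧ y ≡ false → (x ∧ α) ∨ (y ∧ β) ≡ (x ∧ α) xor (y ∧ β)
      disjoint true  true  α β ()
      disjoint true  false α β _ = ≡.trans (∨-falseʳ α) (≡.sym (xor-identityʳ α))
        where
        ∨-falseʳ : ∀ x → x ∨ false ≡ x
        ∨-falseʳ true  = refl
        ∨-falseʳ false = refl
      disjoint false y     α β _ = refl

    attached : ℕ → Fin n → Fin r → ℕ → Bool
    attached m u k i = ((i ≡ᵇ 0) ∧ (u == proj₁ (F k))) ∨ ((suc i ≡ᵇ m) ∧ (u == proj₂ (F k)))

    attached-xor : ∀ m u k i → attached m u k i ≡
      ((i ≡ᵇ 0) ∧ (u == proj₁ (F k))) xor ((suc i ≡ᵇ m) ∧ (u == proj₂ (F k)))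
    attached-xor m u k i = ∨-xor (i ≡ᵇ 0) _ (suc i ≡ᵇ m) _ (distinct-ends k u)

    -- Deleting the edge takes away the color of the opposite end, and the path contributes its
    -- nearest vertex; `seen` records the sum of both changes. For m = 0 the edge stays and both
    -- vanish.
    correction-path : ∀ p v k {m} (ss : Vec (Coloring ⊤) m) →
      parity (λ w → not (m ≡ᵇ 0) ∧ sameEdge (F k) v w) p xor stackParity (λ i _ → attached m v k i) ss ≡
      ((v == proj₁ (F k)) ∧ proj₁ (seen (endColors p k) ss))
      xor ((v == proj₂ (F k)) ∧ proj₂ (seen (endColors p k) ss))
    correction-path p v k [] = cong₂ _xor_ (parity-false p)
      (≡.sym (cong₂ _xor_ (∧-zeroʳ (v == proj₁ (F k))) (∧-zeroʳ (v == proj₂ (F k)))))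
    correction-path p v k {suc m} (s ∷ ss) = ≡.trans (cong₂ _xor_ (edge-parity p v k)
      (≡.trans (stackParity-cong (λ i _ → ≡.trans (attached-xor (suc m) v k i)
                 (cong (λ z → (z ∧ x) xor ((i ≡ᵇ m) ∧ y)) (≡ᵇ-sym i 0))) (s ∷ ss))
        (≡.trans (stackParity-xor (λ i _ → (0 ≡ᵇ i) ∧ x) (λ i _ → (i ≡ᵇ m) ∧ y) (s ∷ ss))
          (cong₂ _xor_ (≡.trans (stackParity-first (λ _ → x) s ss) (parity-const x s))
                       (≡.trans (stackParity-last (λ _ → y) s ss) (parity-const y (end s ss)))))))
      (xor-∧-collect x y (color p (proj₂ (F k))) (color p (proj₁ (F k))) (isBlack s) (isBlack (end s ss)))
      where
      x y : Bool
      x = v == proj₁ (F k)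
      y = v == proj₂ (F k)
      parity-const : ∀ z (c : Coloring ⊤) → parity (λ _ → z) c ≡ z ∧ isBlack c
      parity-const z c = ≡.trans (parity-cong (λ _ → ≡.sym (∧-identityʳ z)) c) (parity-∧ z (λ _ → true) c)

    module _ (c : Fin r → ℕ) where

      adjS : Fin n ⊎ (Fin r × ℕ) → Fin n ⊎ (Fin r × ℕ) → Bool
      adjS = adj (subdivide a F c)

      ι : Fin r → ℕ → Fin n ⊎ (Fin r × ℕ)
      ι k i = inj₂ (k , i)

      subdivided-weight : ∀ p (T : Paths c) → (let all = relabel inj₁ p ++ blocks ι T) →
        Φ all (λ v → parity (adjS v) all) ≈
        baseΦ p (λ k → seen (endColors p k) (T k)) * ∏ (λ k → pathΦ (endColors p k) (T k))
      subdivided-weight p T = ≈-trans (Φ-++ (relabel inj₁ p) (blocks ι T) ρ)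
        (*-cong (≈-trans (Φ-relabel inj₁ p ρ) (Φ-cong p base-parity))
                (≈-trans (Φ-blocks ι T ρ) (∏-cong (λ k →
                  stackΦ-path _ _ (T k) (λ i → ρ (ι k i)) (path-parity k)))))
        where
        ρ : Fin n ⊎ (Fin r × ℕ) → Bool
        ρ v = parity (adjS v) (relabel inj₁ p ++ blocks ι T)

        split : ∀ v → ρ v ≡ parity (λ u → adjS v (inj₁ u)) p
                            xor ⨁ (λ k → stackParity (λ i _ → adjS v (ι k i)) (T k))
        split v = ≡.trans (parity-++ (adjS v) (relabel inj₁ p) _)
          (cong₂ _xor_ (parity-relabel (adjS v) inj₁ p) (parity-blocks (adjS v) ι T))

        removed : Fin n → Fin n → Fin r → Bool
        removed v w k = not (c k ≡ᵇ 0) ∧ sameEdge (F k) v w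

        -- By `removal-parity` the surviving edges are the old row plus one term per subdivided
        -- edge. Regrouped path by path, these terms and the attached path vertices give
        -- `correction`.
        base-parity : ∀ v → ρ (inj₁ v) ≡ parity (a v) p xor correction v (λ k → seen (endColors p k) (T k))
        base-parity v = ≡.trans (split (inj₁ v)) (≡.trans
          (cong (_xor ⨁ (λ k → stackParity (λ i _ → attached (c k) v k i) (T k)))
            (≡.trans (parity-cong (λ w → removal-parity id (removed v w) (a v w)
                       (λ k l k≢l → ∧-false (not (c k ≡ᵇ 0)) (not (c l ≡ᵇ 0)) (distinct-edges v w k l k≢l))
                       (λ k e → are-edges v w k (∧-trueʳ (not (c k ≡ᵇ 0)) e))) p)
              (≡.trans (parity-xor (a v) _ p)
                (cong (parity (a v) p xor_) (parity-⨁ (λ k w → removed v w k) p)))))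
          (≡.trans (xor-assoc (parity (a v) p) _ _) (cong (parity (a v) p xor_)
            (≡.trans (≡.sym (⨁-xor (λ k → parity (λ w → removed v w k) p) _))
                     (⨁-cong (λ k → correction-path p v k (T k)))))))
          where
          ∧-false : ∀ α β {x y} → x ∧ y ≡ false → (α ∧ x) ∧ (β ∧ y) ≡ false
          ∧-false false β             e = refl
          ∧-false true  false {x}     e = ∧-zeroʳ x
          ∧-false true  true          e = e
          ∧-trueʳ : ∀ α {x} → α ∧ x ≡ true → x ≡ true
          ∧-trueʳ true e = e

        path-parity : ∀ k i → ρ (ι k i) ≡
          (((i ≡ᵇ 0) ∧ proj₁ (endColors p k)) xor ((suc i ≡ᵇ c k) ∧ proj₂ (endColors p k)))
          xor stackParity (λ j _ → (suc i ≡ᵇ j) ∨ (suc j ≡ᵇ i)) (T k)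
        path-parity k i = ≡.trans (split (ι k i)) (cong₂ _xor_
          (≡.trans (parity-cong (λ u → attached-xor (c k) u k i) p)
            (≡.trans (parity-xor (λ u → (i ≡ᵇ 0) ∧ (u == proj₁ (F k))) _ p)
              (cong₂ _xor_ (parity-∧ (i ≡ᵇ 0) _ p) (parity-∧ (suc i ≡ᵇ c k) _ p))))
          -- Different paths are not adjacent, so only the summand of path k itself survives.
          (≡.trans (⨁-cong (λ l → stackParity-∧ (k == l) (λ j _ → (suc i ≡ᵇ j) ∨ (suc j ≡ᵇ i)) (T l)))
                   (⨁-δ k (λ l → stackParity (λ j _ → (suc i ≡ᵇ j) ∨ (suc j ≡ᵇ i)) (T l)))))
          where
          stackParity-∧ : ∀ b (σ : ℕ → ⊤ → Bool) {m} (ss : Vec (Coloring ⊤) m) →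
            stackParity (λ j h → b ∧ σ j h) ss ≡ b ∧ stackParity σ ss
          stackParity-∧ true  σ ss = refl
          stackParity-∧ false σ ss = stackParity-false ss

      W-subdivide : W adjS (verts (subdivide a F c)) ≈
                    ∑ (colorings (allFin n)) (λ p → total (endColors p) (baseΦ p) c)
      W-subdivide = begin
        W adjS (map inj₁ (allFin n) ++ concatMap (λ k → map (ι k) (upTo (c k))) (allFin r))
          ≡⟨ cong (λ l → W adjS (map inj₁ (allFin n) ++ l)) (blockVerts-tabulate id ι c) ⟩
        W adjS (map inj₁ (allFin n) ++ blockVerts ι c)
          ≈⟨ ∑-colorings-++ (map inj₁ (allFin n)) (blockVerts ι c) _ ⟩
        _ ≈⟨ ∑-colorings-map inj₁ (allFin n) _ ⟩
        _ ≈⟨ ∑-cong (colorings (allFin n)) (λ p → ≈-trans (∑-colorings-blocks ι c _)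
               (∑ᴾ-cong c (subdivided-weight p))) ⟩
        _ ∎

-- The six families

filterᵇ-all : (p : A → Bool) (xs : List A) → (∀ x → p x ≡ true) → filterᵇ p xs ≡ xs
filterᵇ-all p []       e = refl
filterᵇ-all p (x ∷ xs) e rewrite e x = cong (x ∷_) (filterᵇ-all p xs e)

-- A copy of h opens each layer; moving these copies to the front collects the column of h, which is
-- how `cartesianProduct` lists the vertices.
layers-∷ : (ι : ℕ → H → A) (h : H) (hs : List H) (m : ℕ) →
           layers ι (h ∷ hs) m ↭ applyUpTo (λ i → ι i h) m ++ layers ι hs m
layers-∷ ι h hs zero    = ↭.↭-refl
layers-∷ ι h hs (suc m) = ↭.prep (ι 0 h) (begin
  map (ι 0) hs ++ layers (ι ∘ suc) (h ∷ hs) m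
    ↭⟨ ++⁺ˡ (map (ι 0) hs) (layers-∷ (ι ∘ suc) h hs m) ⟩
  map (ι 0) hs ++ applyUpTo (λ i → ι (suc i) h) m ++ layers (ι ∘ suc) hs m
    ↭⟨ shifts (map (ι 0) hs) (applyUpTo (λ i → ι (suc i) h) m) ⟩
  applyUpTo (λ i → ι (suc i) h) m ++ map (ι 0) hs ++ layers (ι ∘ suc) hs m ∎)
  where open ↭.PermutationReasoning

position : Fin n × Fin m → Fin n × ℕ
position = map₂ toℕ

module _ {n m : ℕ} (keep : Fin n × Fin (suc m) → Bool) (q : Fin n → Bool)
         (keep-spec : ∀ v i → keep (v , i) ≡ (toℕ i ≡ᵇ 0) ∨ q v) where

  private
    column : ∀ {l} v (κ : Fin l → Fin m) (f : ℕ → ℕ) → (∀ i → toℕ (κ i) ≡ f (toℕ i)) →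
      map position (filterᵇ keep (map (v ,_) (tabulate (suc ∘ κ)))) ≡
      (if q v then applyUpTo (λ i → v , suc (f i)) l else [])
    column {zero}  v κ f e = ≡.sym (if-eta (q v))
    column {suc l} v κ f e
      with q v | keep (v , suc (κ zero)) | keep-spec v (suc (κ zero))
         | column v (κ ∘ suc) (f ∘ suc) (e ∘ suc)
    ... | true  | true  | refl | ih = cong₂ _∷_ (cong (λ j → v , suc j) (e zero)) ih
    ... | false | false | refl | ih = ih

  -- Layer 0 keeps all of G and the other layers keep H: a column always contributes its bottom
  -- vertex, and the m others if v lies in H.
  glue-verts : (vs : List (Fin n)) →
    map position (filterᵇ keep (cartesianProduct vs (allFin (suc m)))) ↭
    map (_, 0) vs ++ layers (λ i v → v , suc i) (filterᵇ q vs) m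
  glue-verts []       = ↭.↭-sym (↭.↭-reflexive (layers-[] m))
    where
    layers-[] : ∀ {ι : ℕ → Fin n → Fin n × ℕ} m → layers ι [] m ≡ []
    layers-[] zero    = refl
    layers-[] (suc m) = layers-[] m
  glue-verts (v ∷ vs) = begin
    map position (filterᵇ keep (map (v ,_) (allFin (suc m)) ++ cartesianProduct vs (allFin (suc m))))
      ≡⟨ ≡.trans (cong (map position) (filter-++ (T? ∘ keep) (map (v ,_) (allFin (suc m))) _))
                 (map-++ position (filterᵇ keep (map (v ,_) (allFin (suc m)))) _) ⟩
    map position (filterᵇ keep (map (v ,_) (allFin (suc m)))) ++ others
      ≡⟨ cong (_++ others) first ⟩
    (v , 0) ∷ above ++ others
      ↭⟨ ↭.prep (v , 0) (++⁺ˡ above (glue-verts vs)) ⟩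
    (v , 0) ∷ above ++ map (_, 0) vs ++ layers up (filterᵇ q vs) m
      ↭⟨ ↭.prep (v , 0) (shifts above (map (_, 0) vs)) ⟩
    (v , 0) ∷ map (_, 0) vs ++ above ++ layers up (filterᵇ q vs) m
      ↭⟨ ↭.prep (v , 0) (++⁺ˡ (map (_, 0) vs) rest) ⟩
    map (_, 0) (v ∷ vs) ++ layers up (filterᵇ q (v ∷ vs)) m ∎
    where
    open ↭.PermutationReasoning
    up : ℕ → Fin n → Fin n × ℕ
    up i v = v , suc i
    above others : List (Fin n × ℕ)
    above  = if q v then applyUpTo (λ i → v , suc i) m else []
    others = map position (filterᵇ keep (cartesianProduct vs (allFin (suc m))))
    first : map position (filterᵇ keep (map (v ,_) (allFin (suc m)))) ≡ (v , 0) ∷ above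
    first with keep (v , zero) | keep-spec v zero
    ... | true | refl = cong ((v , 0) ∷_) (column v id id (λ _ → refl))
    rest : above ++ layers up (filterᵇ q vs) m ↭ layers up (filterᵇ q (v ∷ vs)) m
    rest with q v
    ... | true  = ↭.↭-sym (layers-∷ up v (filterᵇ q vs) m)
    ... | false = ↭.↭-refl

-- Edges as unordered pairs

==⇒≡ : {u v : Fin n} → (u == v) ≡ true → u ≡ v
==⇒≡ {u = u} {v} e = toℕ-injective (ℕ.≡ᵇ⇒≡ (toℕ u) (toℕ v) (Equivalence.from T-≡ e))

==-refl : (u : Fin n) → (u == u) ≡ true
==-refl u = Equivalence.to T-≡ (ℕ.≡⇒≡ᵇ (toℕ u) (toℕ u) refl)

≢true⇒false : ∀ {b} → b ≢ true → b ≡ false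
≢true⇒false {true}  ne = ⊥-elim (ne refl)
≢true⇒false {false} ne = refl

∧-true : ∀ {x y} → x ∧ y ≡ true → x ≡ true × y ≡ true
∧-true {true} {true} refl = refl , refl

sameEdge⇒≡ : (e : Fin n × Fin n) (u v : Fin n) → sameEdge e u v ≡ true → e ≡ (u , v) ⊎ e ≡ (v , u)
sameEdge⇒≡ (x , y) u v e with (x == u) ∧ (y == v) in eq
... | true  = inj₁ (cong₂ _,_ (==⇒≡ (proj₁ (∧-true eq))) (==⇒≡ (proj₂ (∧-true eq))))
... | false = inj₂ (cong₂ _,_ (==⇒≡ (proj₁ (∧-true e))) (==⇒≡ (proj₂ (∧-true {x == v} e))))

sameEdge-refl : (u v : Fin n) → sameEdge (u , v) u v ≡ true
sameEdge-refl u v rewrite ==-refl u | ==-refl v = refl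

sameEdge-swap : (u v : Fin n) → sameEdge (u , v) v u ≡ true
sameEdge-swap u v rewrite ==-refl u | ==-refl v = ∨-true _
  where
  ∨-true : ∀ b → b ∨ true ≡ true
  ∨-true true  = refl
  ∨-true false = refl

module _ {n : ℕ} {G : FinAdj n} (simple : IsSimple G) where

  edge-distinct-ends : ∀ {e} → IsEdge G e → ∀ u → (u == proj₁ e) ∧ (u == proj₂ e) ≡ false
  edge-distinct-ends {x , y} edge u = ≢true⇒false λ eq →
    loop (==⇒≡ (proj₁ (∧-true eq))) (==⇒≡ (proj₂ (∧-true {u == x} eq)))
    where
    loop : u ≡ x → u ≢ y
    loop refl refl with () ← ≡.trans (≡.sym edge) (proj₂ simple u)

  sameEdge⇒edge : ∀ {e} → IsEdge G e → ∀ u v → sameEdge e u v ≡ true → G u v ≡ true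
  sameEdge⇒edge {e} edge u v s with sameEdge⇒≡ e u v s
  ... | inj₁ refl = edge
  ... | inj₂ refl = ≡.trans (proj₁ simple u v) edge

sameEdge-disjoint : (e f : Fin n × Fin n) → (e ≈E f) ≡ false → ∀ u v → sameEdge e u v ∧ sameEdge f u v ≡ false
sameEdge-disjoint e f ne u v = ≢true⇒false λ eq →
  both (sameEdge⇒≡ e u v (proj₁ (∧-true eq))) (sameEdge⇒≡ f u v (proj₂ (∧-true {sameEdge e u v} eq)))
  where
  both : e ≡ (u , v) ⊎ e ≡ (v , u) → f ≡ (u , v) ⊎ f ≡ (v , u) → _
  both (inj₁ refl) (inj₁ refl) with () ← ≡.trans (≡.sym ne) (sameEdge-refl u v)
  both (inj₁ refl) (inj₂ refl) with () ← ≡.trans (≡.sym ne) (sameEdge-swap u v)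
  both (inj₂ refl) (inj₁ refl) with () ← ≡.trans (≡.sym ne) (sameEdge-swap v u)
  both (inj₂ refl) (inj₂ refl) with () ← ≡.trans (≡.sym ne) (sameEdge-refl v u)

wholeGraph : FinAdj n → Subgraph n
wholeGraph a = record { inH = λ _ → true ; eH = a }

linked : Subgraph n → Fin n → Fin n → Bool
linked H u v = (u == v) ∧ inH H u

-- α and β mark the first and the last layer, c a cyclic chain. If one layer of a cyclic chain were
-- both, `∨` would see a link where `xor` sees none; the hypothesis excludes this.
∧-∨-xor : ∀ x y α β c → α ∧ β ≡ false → x ∧ y ∧ (α ∨ (c ∧ β)) ≡ (α ∧ (x ∧ y)) xor (β ∧ (c ∧ (x ∧ y)))
∧-∨-xor x     y     true  true  c     ()
∧-∨-xor false y     true  false c     _ = refl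
∧-∨-xor true  false true  false c     _ = refl
∧-∨-xor true  true  true  false c     _ = refl
∧-∨-xor false y     false true  true  _ = refl
∧-∨-xor false y     false true  false _ = refl
∧-∨-xor false y     false false c     _ = refl
∧-∨-xor true  false false true  true  _ = refl
∧-∨-xor true  false false true  false _ = refl
∧-∨-xor true  false false false c     _ = refl
∧-∨-xor true  true  false true  true  _ = refl
∧-∨-xor true  true  false true  false _ = refl
∧-∨-xor true  true  false false true  _ = refl
∧-∨-xor true  true  false false false _ = refl

not-adjacent : ∀ i j → (i ≡ᵇ j) ∧ ((suc i ≡ᵇ j) ∨ (suc j ≡ᵇ i)) ≡ false
not-adjacent zero    zero    = refl
not-adjacent zero    (suc j) = refl
not-adjacent (suc i) zero    = refl
not-adjacent (suc i) (suc j) = not-adjacent i j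

∨-∧-false : ∀ z x y → z ∨ (x ∧ y ∧ false) ≡ z
∨-∧-false z x y = ≡.trans (cong (z ∨_) (≡.trans (cong (x ∧_) (∧-zeroʳ y)) (∧-zeroʳ x))) (∨-identityʳ z)

∨-∧-xor : ∀ α e β x y → α ∧ β ≡ false → (α ∧ e) ∨ (x ∧ y ∧ β) ≡ (α ∧ e) xor (β ∧ (x ∧ y))
∨-∧-xor true  e     true  x     y ()
∨-∧-xor true  e     false x     y _ = ≡.trans (∨-∧-false e x y) (≡.sym (xor-identityʳ e))
∨-∧-xor false e     true  x     y _ = cong (x ∧_) (∧-identityʳ y)
∨-∧-xor false e     false x     y _ = ∨-∧-false false x y

-- Rationality of each family

module Families (R : CommutativeRing 0ℓ 0ℓ) (t : CommutativeRing.Carrier R)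
                {P : CommutativeRing.Carrier R → Set} (sub : IsSubring R P) (t∈ : P t) where
  open CommutativeRing R hiding (zero) renaming (refl to ≈-refl; sym to ≈-sym; trans to ≈-trans)
  open IsSubring sub
  open Sums R
  open Weights R t
  open Subdivision R t
  open PowerSeries R
  open Fractions series (polySubring sub) X (X-poly sub)
  open import Relation.Binary.Reasoning.Setoid setoid

  graphW : Graph → Carrier
  graphW K = W (adj K) (verts K)

  graphW∈ : ∀ K → P (graphW K)
  graphW∈ K = W∈ sub t∈ (adj K) (verts K)

  totalW : List Graph → Carrier
  totalW []       = 0#
  totalW (K ∷ Ks) = graphW K + totalW Ks

  totalW∈ : ∀ Ks → P (totalW Ks)
  totalW∈ []       = 0∈
  totalW∈ (K ∷ Ks) = +∈ (graphW∈ K) (totalW∈ Ks)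

  totalW-map : (g : A → Graph) (xs : List A) → totalW (map g xs) ≈ ∑ xs (graphW ∘ g)
  totalW-map g []       = ≈-refl
  totalW-map g (x ∷ xs) = +-congˡ (totalW-map g xs)

  RationalW : Family → Set
  RationalW 𝒢 = Rat (totalW ∘ 𝒢)

  rat-tail : (f : ℕ → Carrier) → P (f 0) → Rat (f ∘ suc) → Rat f
  rat-tail f p r = rat-resp (λ n → ≈-sym (head-tail f n))
    (rat-+ (rat-∈ (const-poly sub p)) (rat-* (rat-∈ (X-poly sub)) r))

  -- The tail of q f is q times the tail of f plus f 0 times the tail of q. The last summand is a
  -- polynomial, so the same denominator q serves for the tail of f.
  rat-drop : {f : ℕ → Carrier} → P (f 0) → Rat f → Rat (f ∘ suc)
  rat-drop {f} f0∈ (q , d , qf∈) = q , d , Poly.resp (λ n → begin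
      (q ⊛ f) (suc n) + - (const (f 0) ⊛ (q ∘ suc)) n
        ≈⟨ +-cong (⊛-suc′ q f n) (-‿cong (≈-trans (const-⊛ (f 0) (q ∘ suc) n) (*-comm _ _))) ⟩
      q (suc n) * f 0 + (q ⊛ (f ∘ suc)) n + - (q (suc n) * f 0)
        ≈⟨ ≈-trans (+-congʳ (+-comm _ _))
             (≈-trans (+-assoc _ _ _) (≈-trans (+-congˡ (-‿inverseʳ _)) (+-identityʳ _))) ⟩
      (q ⊛ (f ∘ suc)) n ∎)
    (Poly.+∈ (tail-poly qf∈) (Poly.-∈ (Poly.*∈ (const-poly sub f0∈) (tail-poly (denominator∈ d)))))
    where
    module Poly = IsSubring (polySubring sub)
    tail-poly : ∀ {g} → IsPoly P g → IsPoly P (g ∘ suc)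
    tail-poly (p , N , z) = p ∘ suc , N , λ n le → z (suc n) (ℕ.m≤n⇒m≤1+n le)

  module _ {n : ℕ} (a : FinAdj n) (H : Subgraph n) where

    module Glued (cyclic : Bool) = Gluing R t (allFin n) (filterᵇ (inH H) (allFin n)) a (eH H) (linked H) cyclic

    graphW-glue : ∀ cyclic k (b : FinAdj (suc (suc k))) →
      (∀ u i v j → adj (glue a H b) (u , i) (v , j) ≡ Glued.gluedAdj cyclic k (u , toℕ i) (v , toℕ j)) →
      graphW (glue a H b) ≈ W (Glued.gluedAdj cyclic k) (Glued.gluedVerts cyclic k)
    graphW-glue cyclic k b e = begin
      W (adj (glue a H b)) (verts (glue a H b))
        ≈⟨ W-cong {a = adj (glue a H b)} (λ (u , i) (v , j) → e u i v j) (verts (glue a H b)) ⟩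
      W (λ u v → gluedAdj (position u) (position v)) (verts (glue a H b))
        ≈⟨ W-map position gluedAdj (verts (glue a H b)) ⟨
      W gluedAdj (map position (verts (glue a H b)))
        ≈⟨ W-↭ gluedAdj (glue-verts _ (inH H) (λ v i → refl) (allFin n)) ⟩
      W gluedAdj (Glued.gluedVerts cyclic k) ∎
      where
      gluedAdj : Fin n × ℕ → Fin n × ℕ → Bool
      gluedAdj = Glued.gluedAdj cyclic k

    path-glued : ∀ k u i v j → adj (glue a H (adjP (suc (suc k)))) (u , i) (v , j)
                             ≡ Glued.gluedAdj false k (u , toℕ i) (v , toℕ j)
    path-glued k u zero    v zero    = ∨-∧-false (a u v) (u == v) (inH H u)
    path-glued k u zero    v (suc j) =
      ≡.trans (∧-∨-xor (u == v) (inH H u) (0 ≡ᵇ toℕ j) false false (∧-zeroʳ _))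
        (cong (((0 ≡ᵇ toℕ j) ∧ linked H u v) xor_) (≡.sym (∧-zeroʳ (toℕ j ≡ᵇ k))))
    path-glued k u (suc i) v zero    =
      ≡.trans (cong (λ z → (u == v) ∧ inH H u ∧ z) (≡.sym (∨-identityʳ _)))
        (≡.trans (∧-∨-xor (u == v) (inH H u) (0 ≡ᵇ toℕ i) false false (∧-zeroʳ _))
          (cong (((0 ≡ᵇ toℕ i) ∧ linked H u v) xor_) (≡.sym (∧-zeroʳ (toℕ i ≡ᵇ k)))))
    path-glued k u (suc i) v (suc j) =
      ∨-∧-xor (toℕ i ≡ᵇ toℕ j) (eH H u v) _ (u == v) (inH H u) (not-adjacent (toℕ i) (toℕ j))

    -- A cycle of 3 + k layers has k + 2 layers besides the base, numbered from 0, so the last has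
    -- index k + 1 and differs from the first. This is where n ≥ 3 is used.
    first≢last : ∀ i k → (0 ≡ᵇ i) ∧ (i ≡ᵇ suc k) ≡ false
    first≢last zero    k = refl
    first≢last (suc i) k = refl

    cycle-glued : ∀ k u i v j → adj (glue a H (adjC (3 ℕ.+ k))) (u , i) (v , j)
                              ≡ Glued.gluedAdj true (suc k) (u , toℕ i) (v , toℕ j)
    cycle-glued k u zero    v zero    = ∨-∧-false (a u v) (u == v) (inH H u)
    cycle-glued k u zero    v (suc j) =
      ≡.trans (cong (λ z → (u == v) ∧ inH H u ∧ z)
                    (cong₂ _∨_ (∨-identityʳ (0 ≡ᵇ toℕ j)) (∨-identityʳ (toℕ j ≡ᵇ suc k))))
        (∧-∨-xor (u == v) (inH H u) (0 ≡ᵇ toℕ j) (toℕ j ≡ᵇ suc k) true (first≢last (toℕ j) k))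
    cycle-glued k u (suc i) v zero    =
      ∧-∨-xor (u == v) (inH H u) (0 ≡ᵇ toℕ i) (toℕ i ≡ᵇ suc k) true (first≢last (toℕ i) k)
    cycle-glued k u (suc i) v (suc j) =
      ≡.trans (cong (λ z → ((toℕ i ≡ᵇ toℕ j) ∧ eH H u v) ∨ ((u == v) ∧ inH H u ∧ z)) (∨-identityʳ _))
        (∨-∧-xor (toℕ i ≡ᵇ toℕ j) (eH H u v) _ (u == v) (inH H u) (not-adjacent (toℕ i) (toℕ j)))

    extrusions-rational : RationalW (extrusions a H)
    -- Index 0 is empty and index 1 is G alone; index k + 2 has the k + 1 further layers of
    -- `gluedAdj false k`.
    extrusions-rational = rat-tail _ (totalW∈ []) (rat-tail _ (totalW∈ (extrusions a H 1))
      (rat-resp (λ k → ≈-sym (≈-trans (+-identityʳ _) (graphW-glue false k _ (path-glued k))))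
        (Glued.glued-rational false sub t∈)))

    earrings-rational : RationalW (earrings a H)
    -- Three empty terms, then the glued series from k = 1 on. At k = 0 the first and last layers
    -- coincide and their links to the base cancel, so this coefficient is dropped.
    earrings-rational = rat-tail _ (totalW∈ []) (rat-tail _ (totalW∈ []) (rat-tail _ (totalW∈ [])
      (rat-resp (λ k → ≈-sym (≈-trans (+-identityʳ _) (graphW-glue true (suc k) _ (cycle-glued k))))
        (rat-drop (W∈ sub t∈ (Glued.gluedAdj true 0) (Glued.gluedVerts true 0))
          (Glued.glued-rational true sub t∈)))))

  totalW-cong : (𝒢 ℋ : Family) → (∀ n → totalW (𝒢 n) ≈ totalW (ℋ n)) → RationalW ℋ → RationalW 𝒢
  totalW-cong 𝒢 ℋ e = rat-resp (λ n → ≈-sym (e n))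

  module _ {n : ℕ} (a : FinAdj n) where

    graphW-box : ∀ {m} (b : FinAdj m) → graphW (box a b) ≈ graphW (glue a (wholeGraph a) b)
    graphW-box {m} b = begin
      W (adj (box a b)) vs
        ≈⟨ W-cong {a = adj (box a b)} (λ (u , i) (v , j) → ≡.trans (∨-comm ((u == v) ∧ b i j) _)
             (cong (λ z → ((i == j) ∧ z) ∨ ((u == v) ∧ b i j)) (≡.sym (if-eta (toℕ i ≡ᵇ 0))))) vs ⟩
      W glueAdj vs
        ≡⟨ cong (W glueAdj) (≡.sym (filterᵇ-all _ vs (λ (v , i) → ∨-zeroʳ (toℕ i ≡ᵇ 0)))) ⟩
      graphW (glue a (wholeGraph a) b) ∎
      where
      vs : List (Fin n × Fin m)
      vs = cartesianProduct (allFin n) (allFin m)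
      glueAdj : Fin n × Fin m → Fin n × Fin m → Bool
      glueAdj = adj (glue a (wholeGraph a) b)

    cylinders-rational : RationalW (cylinders a)
    cylinders-rational = totalW-cong (cylinders a) (extrusions a (wholeGraph a))
      (λ { zero → ≈-refl ; (suc m) → +-congʳ (graphW-box (adjP (suc m))) })
      (extrusions-rational a (wholeGraph a))

    tori-rational : RationalW (tori a)
    tori-rational = totalW-cong (tori a) (earrings a (wholeGraph a))
      (λ { 0 → ≈-refl ; 1 → ≈-refl ; 2 → ≈-refl ; (suc (suc (suc m))) → +-congʳ (graphW-box (adjC (3 ℕ.+ m))) })
      (earrings-rational a (wholeGraph a))

  module _ {n r : ℕ} {a : FinAdj n} (simple : IsSimple a) (F : Fin r → Fin n × Fin n)
           (edges : ∀ k → IsEdge a (F k)) (distinct : ∀ k l → k ≢ l → (F k ≈E F l) ≡ false) where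

    module S = Subdivided a F (λ k → edge-distinct-ends simple (edges k))
                 (λ u v k l k≢l → sameEdge-disjoint (F k) (F l) (distinct k l k≢l) u v)
                 (λ u v k → sameEdge⇒edge simple (edges k) u v)

    subdivM-rational : RationalW (subdivM a F)
    subdivM-rational = rat-resp (λ s → ≈-sym (begin
        totalW (map (subdivide a F) (compositions r s))
          ≈⟨ totalW-map (subdivide a F) (compositions r s) ⟩
        ∑ (compositions r s) (graphW ∘ subdivide a F)
          ≈⟨ ∑-cong (compositions r s) S.W-subdivide ⟩
        ∑ (compositions r s) (λ c → ∑ (colorings (allFin n)) (λ p → total (S.endColors p) (S.baseΦ p) c))
          ≈⟨ ∑-swap (compositions r s) (colorings (allFin n)) _ ⟩
        _ ≈⟨ ∑-coeff (colorings (allFin n)) _ s ⟨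
        _ ∎))
      (rat-∑ (colorings (allFin n)) (λ {p} _ →
        total-rational sub t∈ (S.endColors p) (S.baseΦ p) (S.baseΦ-cong p) (λ d → Φ∈ sub t∈ p _)))

  subdiv1-rational : {a : FinAdj n} → IsSimple a → (e : Fin n × Fin n) → IsEdge a e → RationalW (subdiv1 a e)
  subdiv1-rational {n} {a} simple e edge = rat-resp (λ m → ≈-sym (begin
      graphW (subdivide a (λ (_ : Fin 1) → e) (λ _ → m)) + 0#
        ≈⟨ +-identityʳ _ ⟩
      graphW (subdivide a (λ (_ : Fin 1) → e) (λ _ → m))
        ≈⟨ S1.W-subdivide (λ _ → m) ⟩
      ∑ (colorings (allFin n)) (λ p → total (S1.endColors p) (S1.baseΦ p) (λ _ → m))
        ≈⟨ ∑-coeff (colorings (allFin n)) _ m ⟨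
      _ ∎))
    (rat-∑ (colorings (allFin n)) (λ {p} _ →
      total₁-rational sub t∈ (S1.endColors p) (S1.baseΦ p) (S1.baseΦ-cong p) (λ d → Φ∈ sub t∈ p _)))
    where
    only-edge : (k l : Fin 1) → k ≢ l → (e ≈E e) ≡ false
    only-edge zero zero k≢l = ⊥-elim (k≢l refl)
    module S1 = S simple (λ (_ : Fin 1) → e) (λ _ → edge) only-edge

-- Coefficients

module ℤt = PowerSeries ℤ.+-*-commutativeRing

constantSubring : IsSubring ℤ.+-*-commutativeRing (λ _ → ⊤)
constantSubring = record
  { resp = λ _ _ → tt ; 0∈ = tt ; 1∈ = tt ; +∈ = λ _ _ → tt ; *∈ = λ _ _ → tt ; -∈ = λ _ → tt }

ℤ[t] : IsSubring ℤt.series (ℤt.IsPoly (λ _ → ⊤))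
ℤ[t] = ℤt.polySubring constantSubring

t∈ : ℤt.IsPoly (λ _ → ⊤) ℤt.X
t∈ = ℤt.X-poly constantSubring

module ℤtx = PowerSeries ℤt.series

open ℤtx using (_⊛_)
open Fractions ℤtx.series (ℤtx.polySubring ℤ[t]) ℤtx.X (ℤtx.X-poly ℤ[t]) using (Denominator; denominator∈)
open Families ℤt.series ℤt.X ℤ[t] t∈
open Weights ℤt.series ℤt.X
open Sums ℤt.series

isEven-count : {A : Set} (r : A → Bool) (c : Coloring A) →
  isEven (countB (λ ub → proj₂ ub ∧ r (proj₁ ub)) c) ≡ not (parity r c)
isEven-count r []            = refl
isEven-count r ((u , b) ∷ c) with b ∧ r u
... | true  = cong not (isEven-count r c)
... | false = isEven-count r c

monomial : ℕ → ℤt.Series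
monomial j k = if j ≡ᵇ k then 1ℤ else 0ℤ

-- Each even-white vertex contributes one factor t. The vertices run through c while neighbours are
-- counted in d, so that c can shrink in the induction; the application takes c = d.
Φ-monomial : {A : Set} (a : A → A → Bool) (c d : Coloring A) →
  Φ c (λ v → parity (a v) d) ℤt.≋
  monomial (countB (λ vb → not (proj₂ vb) ∧ isEven (countB (λ ub → proj₂ ub ∧ a (proj₁ vb) (proj₁ ub)) d)) c)
Φ-monomial a []            d zero    = refl
Φ-monomial a []            d (suc k) = refl
Φ-monomial a ((v , b) ∷ c) d k rewrite isEven-count (a v) d with b | parity (a v) d
... | true  | _     = ≡.trans (CommutativeRing.*-identityˡ ℤt.series _ k) (Φ-monomial a c d k)
... | false | true  = ≡.trans (CommutativeRing.*-identityˡ ℤt.series _ k) (Φ-monomial a c d k)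
Φ-monomial a ((v , b) ∷ c) d zero    | false | false = ℤ.*-zeroˡ (Φ c (λ w → parity (a w) d) 0)
Φ-monomial a ((v , b) ∷ c) d (suc k) | false | false = ≡.trans (ℤt.X-⊛-suc _ k) (Φ-monomial a c d k)

count-monomial : {A : Set} (j : A → ℕ) (xs : List A) (k : ℕ) →
  + countB (λ x → j x ≡ᵇ k) xs ≡ ∑ xs (monomial ∘ j) k
count-monomial j []       k = refl
count-monomial j (x ∷ xs) k with j x ≡ᵇ k
... | true  = cong (1ℤ +ℤ_) (count-monomial j xs k)
... | false = ≡.trans (count-monomial j xs k) (≡.sym (ℤ.+-identityˡ _))

Wcoeff-graphW : ∀ K k → + Wcoeff K k ≡ graphW K k
Wcoeff-graphW K k = ≡.trans (count-monomial (evenWhite (adj K)) (colorings (verts K)) k)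
  (∑-cong (colorings (verts K)) (λ c i → ≡.sym (Φ-monomial (adj K) c c i)) k)

totalW-Ξ : ∀ 𝒢 n k → totalW (𝒢 n) k ≡ Ξcoeff 𝒢 n k
totalW-Ξ 𝒢 n k = go (𝒢 n)
  where
  go : ∀ Ks → totalW Ks k ≡ + sumℕ (map (λ K → Wcoeff K k) Ks)
  go []       = refl
  go (K ∷ Ks) = ≡.trans (cong₂ _+ℤ_ (≡.sym (Wcoeff-graphW K k)) (go Ks)) (≡.sym (ℤ.pos-+ (Wcoeff K k) _))

sumTo-cong : ∀ n {f g : ℕ → ℤ} → (∀ i → f i ≡ g i) → sumTo n f ≡ sumTo n g
sumTo-cong zero    e = e 0
sumTo-cong (suc n) e = cong₂ _+ℤ_ (sumTo-cong n e) (e (suc n))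

sumTo-suc : ∀ n f → sumTo (suc n) f ≡ f 0 +ℤ sumTo n (f ∘ suc)
sumTo-suc zero    f = refl
sumTo-suc (suc n) f = ≡.trans (cong (_+ℤ f (suc (suc n))) (sumTo-suc n f)) (ℤ.+-assoc (f 0) _ _)

⊛-sumTo : ∀ f g k → (f ℤt.⊛ g) k ≡ sumTo k (λ j → f j *ℤ g (k ℕ.∸ j))
⊛-sumTo f g zero    = refl
⊛-sumTo f g (suc k) = ≡.trans (cong (f 0 *ℤ g (suc k) +ℤ_) (⊛-sumTo (f ∘ suc) g k))
  (≡.sym (sumTo-suc k (λ j → f j *ℤ g (suc k ℕ.∸ j))))

⊛-sumTo₂ : ∀ f g n k → (f ⊛ g) n k ≡ sumTo n (λ i → sumTo k (λ j → f i j *ℤ g (n ℕ.∸ i) (k ℕ.∸ j)))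
⊛-sumTo₂ f g zero    k = ⊛-sumTo (f 0) (g 0) k
⊛-sumTo₂ f g (suc n) k = ≡.trans (cong₂ _+ℤ_ (⊛-sumTo (f 0) (g (suc n)) k) (⊛-sumTo₂ (f ∘ suc) g n k))
  (≡.sym (sumTo-suc n (λ i → sumTo k (λ j → f i j *ℤ g (suc n ℕ.∸ i) (k ℕ.∸ j)))))

at-applyUpTo : ∀ N (f : ℕ → ℤ) → (∀ i → N ≤ i → f i ≡ 0ℤ) → ∀ i → at (applyUpTo f N) i ≡ f i
at-applyUpTo zero    f z i       = ≡.sym (z i z≤n)
at-applyUpTo (suc N) f z zero    = refl
at-applyUpTo (suc N) f z (suc i) = at-applyUpTo N (f ∘ suc) (λ i le → z (suc i) (s≤s le)) i

atL-applyUpTo : ∀ N (g : ℕ → List ℤ) (f : ℕ → ℕ → ℤ) → (∀ i j → at (g i) j ≡ f i j) →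
  (∀ i → N ≤ i → ∀ j → f i j ≡ 0ℤ) → ∀ i j → at (atL (applyUpTo g N) i) j ≡ f i j
atL-applyUpTo zero    g f e z i       j = ≡.sym (z i z≤n j)
atL-applyUpTo (suc N) g f e z zero    j = e 0 j
atL-applyUpTo (suc N) g f e z (suc i) j =
  atL-applyUpTo N (g ∘ suc) (f ∘ suc) (e ∘ suc) (λ i le → z (suc i) (s≤s le)) i j

-- The outer bound cuts off the powers of x, and each coefficient brings its own bound for the
-- powers of t. Past the ends of the lists all coefficients read as zero, as in the series.
poly-list : ∀ {f} → ℤtx.IsPoly (ℤt.IsPoly (λ _ → ⊤)) f → ∃ λ L → ∀ i j → coeff2 L i j ≡ f i j
poly-list {f} (p , N , z) = applyUpTo (λ i → applyUpTo (f i) (proj₁ (proj₂ (p i)))) N ,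
  atL-applyUpTo N _ f (λ i → at-applyUpTo (proj₁ (proj₂ (p i))) (f i) (proj₂ (proj₂ (p i)))) z

rational : ∀ 𝒢 → RationalW 𝒢 → Rational 𝒢
rational 𝒢 (q , den , qΞ∈) with poly-list (denominator∈ den) | poly-list qΞ∈
-- The witness is j = 0: the denominator 1 + x u has coefficient 1 at degree 0 in both x and t.
... | Q , Q≡ | P , P≡ = P , Q , (0 , nonzero den) , λ n k → ≡.trans
    (sumTo-cong n (λ i → sumTo-cong k (λ j → cong₂ _*ℤ_ (Q≡ i j) (≡.sym (totalW-Ξ 𝒢 (n ℕ.∸ i) (k ℕ.∸ j))))))
    (≡.trans (≡.sym (⊛-sumTo₂ q (totalW ∘ 𝒢) n k)) (≡.sym (P≡ n k)))
  where
  nonzero : Denominator q → coeff2 Q 0 0 ≢ 0ℤ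
  nonzero (u , _ , e) eq with () ← ≡.trans (≡.sym eq)
    (≡.trans (Q≡ 0 0) (≡.trans (e 0 0) (cong (1ℤ +ℤ_) (ℤ.*-zeroˡ (u 0 0)))))

theorem2p3 : (n : ℕ) (G : FinAdj n) → IsSimple G →
    Rational (cylinders G)
    × ((H : Subgraph n) → IsSubgraph G H → Rational (extrusions G H))
    × Rational (tori G)
    × ((H : Subgraph n) → IsSubgraph G H → Rational (earrings G H))
    × ((e : Fin n × Fin n) → IsEdge G e → Rational (subdiv1 G e))
    × ((r : ℕ) (F : Fin r → Fin n × Fin n) → (∀ k → IsEdge G (F k))
    → (∀ k l → k ≢ l → (F k ≈E F l) ≡ false)
    → Rational (subdivM G F))
theorem2p3 n G simple =
    rational (cylinders G) (cylinders-rational G)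
  , (λ H _ → rational (extrusions G H) (extrusions-rational G H))
  , rational (tori G) (tori-rational G)
  , (λ H _ → rational (earrings G H) (earrings-rational G H))
  , (λ e edge → rational (subdiv1 G e) (subdiv1-rational simple e edge))
  , (λ r F edges distinct → rational (subdivM G F) (subdivM-rational simple F edges distinct))
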